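{- For every integer $n\geq 1$, $$F_{n}(y,t)=(1+yt)(1+yt^{2})^{n-1}\,P_{n}^{(\mathrm{lpk},\mathrm{val},\mathrm{des})}\left(\frac{t(1+y)(y+t)}{(y+t^{2})(1+yt)},\frac{t(1+y)(1+yt)}{(1+yt^{2})(y+t)},\frac{y+t^{2}}{1+yt^{2}}\right).$$
   Context: $\mathfrak{S}_n$ is the set of permutations $\pi=\pi_1\cdots\pi_n$ of $[n]=\{1,\dots,n\}$. For $\pi\in\mathfrak{S}_n$: $\mathrm{des}(\pi)$ is the number of $i\in[n-1]$ with $\pi_i>\pi_{i+1}$; $\mathrm{lpk}(\pi)$ is the number of left peaks, where $i\in[n-1]$ is a left peak if either $2\le i\le n-1$ and $\pi_{i-1}<\pi_i>\pi_{i+1}$, or $i=1$ and $\pi_1>\pi_2$; $\mathrm{val}(\pi)$ is the number of valleys, i.e. of $i$ with $2\le i\le n-1$ and $\pi_{i-1}>\pi_i<\pi_{i+1}$. $P_n^{(\mathrm{lpk},\mathrm{val},\mathrm{des})}(y,z,t)=\sum_{\pi\in\mathfrak{S}_n}y^{\mathrm{lpk}(\pi)}z^{\mathrm{val}(\pi)}t^{\mathrm{des}(\pi)}$ for $n\ge1$. $\mathfrak{B}_n$ is the set of signed permutations: permutations $\pi$ of $\{ -n,\dots,-1,0,1,\dots,n\}$ with $\pi_{ -i}=-\pi_i$ for all $i$ (so $\pi_0=0$), written $\pi=\pi_1\cdots\pi_n$. For $\pi\in\mathfrak{B}_n$: $\mathrm{des}_B(\pi)$ is the number of $i\in\{0,1,\dots,n-1\}$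 with $\pi_i>\pi_{i+1}$ (where $\pi_0=0$); the flag descent number $\mathrm{fdes}(\pi)$ is $2\,\mathrm{des}_B(\pi)$ if $\pi_1>0$ and $2\,\mathrm{des}_B(\pi)-1$ if $\pi_1<0$; $\mathrm{neg}(\pi)$ is the number of $i\in[n]$ with $\pi_i<0$. $F_n(y,t)=\sum_{\pi\in\mathfrak{B}_n}y^{\mathrm{neg}(\pi)}t^{\mathrm{fdes}(\pi)}$ for $n\ge1$. The identity is one of rational functions in the indeterminates $y,t$. -}

module Defs where

open import Level using (Level; 0ℓ; _⊔_) renaming (suc to lsuc)
open import Algebra.Bundles using (CommutativeRing; Semiring)
open import Algebra.Structures using (IsCommutativeRing)
import Algebra.Properties.Ring as RingProperties
import Algebra.Properties.AbelianGroup as AbelianGroupProperties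
import Algebra.Properties.CommutativeSemigroup as CommutativeSemigroupProperties
import Algebra.Properties.Semiring.Exp as Exp
import Algebra.Solver.Ring.NaturalCoefficients.Default as SemiringSolver
open import Data.Nat.Base as ℕ using (ℕ; zero; suc)
import Data.Nat.Properties as ℕ
open import Data.Integer.Base as ℤ using (ℤ; +_)
import Data.Integer.Properties as ℤ
open import Data.Rational.Base as ℚ using (ℚ)
import Data.Rational.Properties as ℚ
open import Data.List.Base
  using (List; []; _∷_; _++_; map; foldr; filter; length; reverse; upTo;
         cartesianProductWith)
open import Data.List.Relation.Unary.Unique.DecPropositional ℕ._≟_
  using () renaming (unique? to uniqueℕ?)
open import Data.List.Relation.Unary.Unique.DecPropositional ℤ._≟_
  using () renaming (unique? to uniqueℤ?)
open import Data.Product.Base using (_,_)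
open import Data.Sum.Base as Sum using (_⊎_; inj₁; inj₂; [_,_]′)
open import Data.Empty using (⊥-elim)
open import Function.Base using (_∘_)
open import Relation.Binary.PropositionalEquality.Core as ≡ using (_≡_)
open import Relation.Binary.Bundles using (Setoid)
open import Relation.Binary.Structures using (IsEquivalence)
open import Relation.Nullary.Decidable.Core using (does; yes; no)
open import Relation.Nullary.Negation.Core using (¬_)
open import Data.Bool.Base using (if_then_else_; _∧_)
import Relation.Binary.Reasoning.Setoid as SetoidReasoning

------------------------------------------------------------------------
-- Permutations

-- All words of length n over a finite alphabet.
words : {A : Set} → List A → ℕ → List (List A)
words alphabet zero    = [] ∷ []
words alphabet (suc n) = cartesianProductWith _∷_ alphabet (words alphabet n)

-- π₁⋯πₙ with letters in {1,…,n}; an injective self-map of a finite set is a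
-- permutation.
𝔖 : ℕ → List (List ℕ)
𝔖 n = filter uniqueℕ? (words (map suc (upTo n)) n)

-- The word π₋ₙ⋯π₋₁π₀π₁⋯πₙ determined by π₁⋯πₙ and π₋ᵢ = −πᵢ.
symmetricWord : List ℤ → List ℤ
symmetricWord w = reverse (map ℤ.-_ w) ++ ℤ.0ℤ ∷ w

-- π₁⋯πₙ with letters in {−n,…,n} whose antisymmetric extension to {−n,…,n} is
-- injective, hence a permutation.
𝔅 : ℕ → List (List ℤ)
𝔅 n = filter (λ w → uniqueℤ? (symmetricWord w))
             (words (map (λ k → + k ℤ.- + n) (upTo (suc (2 ℕ.* n)))) n)

------------------------------------------------------------------------
-- Statistics

des : List ℕ → ℕ
des (a ∷ b ∷ w) = (if does (b ℕ.<? a) then 1 else 0) ℕ.+ des (b ∷ w)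
des _           = 0

-- Interior peaks: i with 2 ≤ i ≤ n−1 and πᵢ₋₁ < πᵢ > πᵢ₊₁.
pk : List ℕ → ℕ
pk (a ∷ b ∷ c ∷ w) =
  (if does (a ℕ.<? b) ∧ does (c ℕ.<? b) then 1 else 0) ℕ.+ pk (b ∷ c ∷ w)
pk _               = 0

lpk : List ℕ → ℕ
lpk (a ∷ b ∷ w) = (if does (b ℕ.<? a) then 1 else 0) ℕ.+ pk (a ∷ b ∷ w)
lpk _           = 0

val : List ℕ → ℕ
val (a ∷ b ∷ c ∷ w) =
  (if does (b ℕ.<? a) ∧ does (b ℕ.<? c) then 1 else 0) ℕ.+ val (b ∷ c ∷ w)
val _               = 0

desℤ : List ℤ → ℕ
desℤ (a ∷ b ∷ w) = (if does (b ℤ.<? a) then 1 else 0) ℕ.+ desℤ (b ∷ w)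
desℤ _           = 0

desB : List ℤ → ℕ
desB w = desℤ (ℤ.0ℤ ∷ w)

-- The truncated subtraction is exact: if π₁ < 0 then 0 is a descent.
fdes : List ℤ → ℕ
fdes []      = 0
fdes (a ∷ w) =
  if does (a ℤ.<? ℤ.0ℤ) then 2 ℕ.* desB (a ∷ w) ℕ.∸ 1 else 2 ℕ.* desB (a ∷ w)

neg : List ℤ → ℕ
neg w = length (filter (ℤ._<? ℤ.0ℤ) w)

------------------------------------------------------------------------
-- The polynomials P and F, evaluated at elements of a commutative ring

module Enumerators {c ℓ} (R : CommutativeRing c ℓ) where
  open CommutativeRing R
  open Exp semiring public using (_^_)

  Σ[_]_ : {A : Set} → List A → (A → Carrier) → Carrier
  Σ[ xs ] f = foldr _+_ 0# (map f xs)

  P : ℕ → Carrier → Carrier → Carrier → Carrier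
  P n y z t = Σ[ 𝔖 n ] λ π → y ^ lpk π * z ^ val π * t ^ des π

  F : ℕ → Carrier → Carrier → Carrier
  F n y t = Σ[ 𝔅 n ] λ π → y ^ neg π * t ^ fdes π

------------------------------------------------------------------------
-- Integral domains

record IntegralDomain c ℓ : Set (lsuc (c ⊔ ℓ)) where
  field
    commutativeRing : CommutativeRing c ℓ
  open CommutativeRing commutativeRing public
  field
    1≉0      : ¬ 1# ≈ 0#
    integral : ∀ x y → x * y ≈ 0# → x ≈ 0# ⊎ y ≈ 0#

  *-≉0 : ∀ {x y} → ¬ x ≈ 0# → ¬ y ≈ 0# → ¬ x * y ≈ 0#
  *-≉0 {x} {y} x≉0 y≉0 xy≈0 with integral x y xy≈0
  ... | inj₁ x≈0 = x≉0 x≈0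
  ... | inj₂ y≈0 = y≉0 y≈0

  *-cancelˡ : ∀ {x y z} → ¬ x ≈ 0# → x * y ≈ x * z → y ≈ z
  *-cancelˡ {x} {y} {z} x≉0 xy≈xz
    with integral x (y - z)
           (trans (RingProperties.x[y-z]≈xy-xz ring x y z)
                  (AbelianGroupProperties.x≈y⇒x∙y⁻¹≈ε +-abelianGroup xy≈xz))
  ... | inj₁ x≈0   = ⊥-elim (x≉0 x≈0)
  ... | inj₂ y-z≈0 = AbelianGroupProperties.x∙y⁻¹≈ε⇒x≈y +-abelianGroup y z y-z≈0

ℚ-integralDomain : IntegralDomain 0ℓ 0ℓ
ℚ-integralDomain = record
  { commutativeRing = ℚ.+-*-commutativeRing
  ; 1≉0             = λ ()
  ; integral        = integral
  }
  where
  integral : ∀ p q → p ℚ.* q ≡ ℚ.0ℚ → p ≡ ℚ.0ℚ ⊎ q ≡ ℚ.0ℚ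
  integral p q pq≡0 with p ℚ.≟ ℚ.0ℚ
  ... | yes p≡0 = inj₁ p≡0
  ... | no  p≢0 = inj₂ (begin
    q                    ≡⟨ ℚ.*-identityˡ q ⟨
    ℚ.1ℚ ℚ.* q           ≡⟨ ≡.cong (ℚ._* q) (ℚ.*-inverseˡ p) ⟨
    (ℚ.1/ p) ℚ.* p ℚ.* q ≡⟨ ℚ.*-assoc (ℚ.1/ p) p q ⟩
    (ℚ.1/ p) ℚ.* (p ℚ.* q) ≡⟨ ≡.cong ((ℚ.1/ p) ℚ.*_) pq≡0 ⟩
    (ℚ.1/ p) ℚ.* ℚ.0ℚ    ≡⟨ ℚ.*-zeroʳ (ℚ.1/ p) ⟩
    ℚ.0ℚ                 ∎)
    where
    open import Relation.Binary.PropositionalEquality.Properties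
      using (module ≡-Reasoning)
    open ≡-Reasoning
    instance
      p-nonZero : ℚ.NonZero p
      p-nonZero = ℚ.≢-nonZero p≢0

------------------------------------------------------------------------
-- Polynomials in one variable

module Polynomial {c ℓ} (D : IntegralDomain c ℓ) where
  open IntegralDomain D
  open CommutativeSemigroupProperties +-commutativeSemigroup using ()
    renaming (interchange to +-interchange)

  -- Coefficients from degree 0 upwards; trailing zeros are allowed.
  Poly : Set c
  Poly = List Carrier

  coeff : Poly → ℕ → Carrier
  coeff []      i       = 0#
  coeff (a ∷ p) zero    = a
  coeff (a ∷ p) (suc i) = coeff p i

  infix 4 _≈ₚ_
  record _≈ₚ_ (p q : Poly) : Set ℓ where
    constructor mk≈
    field coeff≈ : ∀ i → coeff p i ≈ coeff q i
  open _≈ₚ_ public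

  infixl 6 _+ₚ_
  infixl 7 _*ₚ_ _·_
  infix  8 -ₚ_

  _+ₚ_ : Poly → Poly → Poly
  []      +ₚ q       = q
  (a ∷ p) +ₚ []      = a ∷ p
  (a ∷ p) +ₚ (b ∷ q) = a + b ∷ p +ₚ q

  -ₚ_ : Poly → Poly
  -ₚ p = map -_ p

  _·_ : Carrier → Poly → Poly
  a · p = map (a *_) p

  _*ₚ_ : Poly → Poly → Poly
  []      *ₚ q = []
  (a ∷ p) *ₚ q = a · q +ₚ (0# ∷ p *ₚ q)

  const : Carrier → Poly
  const a = a ∷ []

  X : Poly
  X = 0# ∷ 1# ∷ []

  private
    ≈ₚ-refl : ∀ {p} → p ≈ₚ p
    ≈ₚ-refl = mk≈ λ i → refl

    ≈ₚ-sym : ∀ {p q} → p ≈ₚ q → q ≈ₚ p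
    ≈ₚ-sym e = mk≈ λ i → sym (coeff≈ e i)

    ≈ₚ-trans : ∀ {p q r} → p ≈ₚ q → q ≈ₚ r → p ≈ₚ r
    ≈ₚ-trans e f = mk≈ λ i → trans (coeff≈ e i) (coeff≈ f i)

    coeff-+ : ∀ p q i → coeff (p +ₚ q) i ≈ coeff p i + coeff q i
    coeff-+ []      q       i       = sym (+-identityˡ _)
    coeff-+ (a ∷ p) []      i       = sym (+-identityʳ _)
    coeff-+ (a ∷ p) (b ∷ q) zero    = refl
    coeff-+ (a ∷ p) (b ∷ q) (suc i) = coeff-+ p q i

    coeff-neg : ∀ p i → coeff (-ₚ p) i ≈ - coeff p i
    coeff-neg []      i       = sym (RingProperties.-0#≈0# ring)
    coeff-neg (a ∷ p) zero    = refl
    coeff-neg (a ∷ p) (suc i) = coeff-neg p i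

    coeff-· : ∀ a p i → coeff (a · p) i ≈ a * coeff p i
    coeff-· a []      i       = sym (zeroʳ a)
    coeff-· a (b ∷ p) zero    = refl
    coeff-· a (b ∷ p) (suc i) = coeff-· a p i

    ∷-cong : ∀ {a b p q} → a ≈ b → p ≈ₚ q → (a ∷ p) ≈ₚ (b ∷ q)
    ∷-cong e f = mk≈ λ { zero → e ; (suc i) → coeff≈ f i }

    ∷-zero : ∀ {a p} → a ≈ 0# → p ≈ₚ [] → (a ∷ p) ≈ₚ []
    ∷-zero e f = mk≈ λ { zero → e ; (suc i) → coeff≈ f i }

    +ₚ-cong : ∀ {p p′ q q′} → p ≈ₚ p′ → q ≈ₚ q′ → p +ₚ q ≈ₚ p′ +ₚ q′
    +ₚ-cong {p} {p′} {q} {q′} e f = mk≈ λ i →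
      trans (coeff-+ p q i)
        (trans (+-cong (coeff≈ e i) (coeff≈ f i)) (sym (coeff-+ p′ q′ i)))

    +ₚ-comm : ∀ p q → p +ₚ q ≈ₚ q +ₚ p
    +ₚ-comm p q = mk≈ λ i →
      trans (coeff-+ p q i) (trans (+-comm _ _) (sym (coeff-+ q p i)))

    +ₚ-assoc : ∀ p q r → (p +ₚ q) +ₚ r ≈ₚ p +ₚ (q +ₚ r)
    +ₚ-assoc p q r = mk≈ λ i → begin
      coeff ((p +ₚ q) +ₚ r) i               ≈⟨ coeff-+ (p +ₚ q) r i ⟩
      coeff (p +ₚ q) i + coeff r i          ≈⟨ +-congʳ (coeff-+ p q i) ⟩
      (coeff p i + coeff q i) + coeff r i   ≈⟨ +-assoc _ _ _ ⟩
      coeff p i + (coeff q i + coeff r i)   ≈⟨ +-congˡ (coeff-+ q r i) ⟨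
      coeff p i + coeff (q +ₚ r) i          ≈⟨ coeff-+ p (q +ₚ r) i ⟨
      coeff (p +ₚ (q +ₚ r)) i               ∎
      where open SetoidReasoning setoid

    +ₚ-identityʳ : ∀ p → p +ₚ [] ≈ₚ p
    +ₚ-identityʳ p = +ₚ-comm p []

    +ₚ-inverseˡ : ∀ p → -ₚ p +ₚ p ≈ₚ []
    +ₚ-inverseˡ p = mk≈ λ i →
      trans (coeff-+ (-ₚ p) p i)
        (trans (+-congʳ (coeff-neg p i)) (-‿inverseˡ _))

    -ₚ-cong : ∀ {p q} → p ≈ₚ q → -ₚ p ≈ₚ -ₚ q
    -ₚ-cong {p} {q} e = mk≈ λ i →
      trans (coeff-neg p i)
        (trans (-‿cong (coeff≈ e i)) (sym (coeff-neg q i)))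

    +ₚ-interchange : ∀ p q r s →
      (p +ₚ q) +ₚ (r +ₚ s) ≈ₚ (p +ₚ r) +ₚ (q +ₚ s)
    +ₚ-interchange p q r s = mk≈ λ i → begin
      coeff ((p +ₚ q) +ₚ (r +ₚ s)) i
        ≈⟨ coeff-+ (p +ₚ q) (r +ₚ s) i ⟩
      coeff (p +ₚ q) i + coeff (r +ₚ s) i
        ≈⟨ +-cong (coeff-+ p q i) (coeff-+ r s i) ⟩
      (coeff p i + coeff q i) + (coeff r i + coeff s i)
        ≈⟨ +-interchange _ _ _ _ ⟩
      (coeff p i + coeff r i) + (coeff q i + coeff s i)
        ≈⟨ +-cong (coeff-+ p r i) (coeff-+ q s i) ⟨
      coeff (p +ₚ r) i + coeff (q +ₚ s) i
        ≈⟨ coeff-+ (p +ₚ r) (q +ₚ s) i ⟨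
      coeff ((p +ₚ r) +ₚ (q +ₚ s)) i ∎
      where open SetoidReasoning setoid

    ·-cong : ∀ {a b p q} → a ≈ b → p ≈ₚ q → a · p ≈ₚ b · q
    ·-cong {a} {b} {p} {q} e f = mk≈ λ i →
      trans (coeff-· a p i)
        (trans (*-cong e (coeff≈ f i)) (sym (coeff-· b q i)))

    ·-distribˡ : ∀ a p q → a · (p +ₚ q) ≈ₚ a · p +ₚ a · q
    ·-distribˡ a p q = mk≈ λ i → begin
      coeff (a · (p +ₚ q)) i               ≈⟨ coeff-· a (p +ₚ q) i ⟩
      a * coeff (p +ₚ q) i                 ≈⟨ *-congˡ (coeff-+ p q i) ⟩
      a * (coeff p i + coeff q i)          ≈⟨ distribˡ _ _ _ ⟩
      a * coeff p i + a * coeff q i        ≈⟨ +-cong (coeff-· a p i) (coeff-· a q i) ⟨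
      coeff (a · p) i + coeff (a · q) i    ≈⟨ coeff-+ (a · p) (a · q) i ⟨
      coeff (a · p +ₚ a · q) i             ∎
      where open SetoidReasoning setoid

    ·-distribʳ : ∀ a b p → (a + b) · p ≈ₚ a · p +ₚ b · p
    ·-distribʳ a b p = mk≈ λ i → begin
      coeff ((a + b) · p) i                ≈⟨ coeff-· (a + b) p i ⟩
      (a + b) * coeff p i                  ≈⟨ distribʳ _ _ _ ⟩
      a * coeff p i + b * coeff p i        ≈⟨ +-cong (coeff-· a p i) (coeff-· b p i) ⟨
      coeff (a · p) i + coeff (b · p) i    ≈⟨ coeff-+ (a · p) (b · p) i ⟨
      coeff (a · p +ₚ b · p) i             ∎
      where open SetoidReasoning setoid

    ·-assoc : ∀ a b p → (a * b) · p ≈ₚ a · (b · p)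
    ·-assoc a b p = mk≈ λ i → begin
      coeff ((a * b) · p) i    ≈⟨ coeff-· (a * b) p i ⟩
      a * b * coeff p i        ≈⟨ *-assoc _ _ _ ⟩
      a * (b * coeff p i)      ≈⟨ *-congˡ (coeff-· b p i) ⟨
      a * coeff (b · p) i      ≈⟨ coeff-· a (b · p) i ⟨
      coeff (a · (b · p)) i    ∎
      where open SetoidReasoning setoid

    0·-zero : ∀ {a} p → a ≈ 0# → a · p ≈ₚ []
    0·-zero {a} p e = mk≈ λ i →
      trans (coeff-· a p i) (trans (*-congʳ e) (zeroˡ _))

    1·-identity : ∀ p → 1# · p ≈ₚ p
    1·-identity p = mk≈ λ i → trans (coeff-· 1# p i) (*-identityˡ _)

    0∷-+ : ∀ p q → (0# ∷ p +ₚ q) ≈ₚ (0# ∷ p) +ₚ (0# ∷ q)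
    0∷-+ p q = ∷-cong (sym (+-identityˡ 0#)) ≈ₚ-refl

    0∷-* : ∀ {a} p q → a ≈ 0# → (a ∷ p) *ₚ q ≈ₚ (0# ∷ p *ₚ q)
    0∷-* p q e = +ₚ-cong (0·-zero q e) ≈ₚ-refl

    *ₚ-congˡ : ∀ p {q r} → q ≈ₚ r → p *ₚ q ≈ₚ p *ₚ r
    *ₚ-congˡ []      e = ≈ₚ-refl
    *ₚ-congˡ (a ∷ p) e = +ₚ-cong (·-cong refl e) (∷-cong refl (*ₚ-congˡ p e))

    *ₚ-zeroʳ : ∀ p → p *ₚ [] ≈ₚ []
    *ₚ-zeroʳ []      = ≈ₚ-refl
    *ₚ-zeroʳ (a ∷ p) = ∷-zero refl (*ₚ-zeroʳ p)

  private
    ≈ₚ-isEquivalence : IsEquivalence _≈ₚ_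
    ≈ₚ-isEquivalence =
      record { refl = ≈ₚ-refl ; sym = ≈ₚ-sym ; trans = ≈ₚ-trans }

    ≈ₚ-setoid : Setoid c ℓ
    ≈ₚ-setoid = record { isEquivalence = ≈ₚ-isEquivalence }

    open SetoidReasoning ≈ₚ-setoid

    *ₚ-∷ : ∀ p b q → p *ₚ (b ∷ q) ≈ₚ b · p +ₚ (0# ∷ p *ₚ q)
    *ₚ-∷ []      b q = ≈ₚ-sym (∷-zero refl ≈ₚ-refl)
    *ₚ-∷ (a ∷ p) b q = ∷-cong (+-congʳ (*-comm a b)) (begin
      a · q +ₚ p *ₚ (b ∷ q)                ≈⟨ +ₚ-cong ≈ₚ-refl (*ₚ-∷ p b q) ⟩
      a · q +ₚ (b · p +ₚ (0# ∷ p *ₚ q))    ≈⟨ +ₚ-assoc (a · q) (b · p) _ ⟨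
      a · q +ₚ b · p +ₚ (0# ∷ p *ₚ q)      ≈⟨ +ₚ-cong (+ₚ-comm (a · q) (b · p)) ≈ₚ-refl ⟩
      b · p +ₚ a · q +ₚ (0# ∷ p *ₚ q)      ≈⟨ +ₚ-assoc (b · p) (a · q) _ ⟩
      b · p +ₚ (a · q +ₚ (0# ∷ p *ₚ q))    ∎)

    *ₚ-comm : ∀ p q → p *ₚ q ≈ₚ q *ₚ p
    *ₚ-comm p []      = *ₚ-zeroʳ p
    *ₚ-comm p (b ∷ q) = ≈ₚ-trans (*ₚ-∷ p b q)
      (+ₚ-cong ≈ₚ-refl (∷-cong refl (*ₚ-comm p q)))

    *ₚ-cong : ∀ {p p′ q q′} → p ≈ₚ p′ → q ≈ₚ q′ → p *ₚ q ≈ₚ p′ *ₚ q′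
    *ₚ-cong {p} {p′} {q} {q′} e f = begin
      p *ₚ q    ≈⟨ *ₚ-congˡ p f ⟩
      p *ₚ q′   ≈⟨ *ₚ-comm p q′ ⟩
      q′ *ₚ p   ≈⟨ *ₚ-congˡ q′ e ⟩
      q′ *ₚ p′  ≈⟨ *ₚ-comm q′ p′ ⟩
      p′ *ₚ q′  ∎

    *ₚ-distribʳ : ∀ r p q → (p +ₚ q) *ₚ r ≈ₚ p *ₚ r +ₚ q *ₚ r
    *ₚ-distribʳ r []      q       = ≈ₚ-refl
    *ₚ-distribʳ r (a ∷ p) []      = ≈ₚ-sym (+ₚ-identityʳ _)
    *ₚ-distribʳ r (a ∷ p) (b ∷ q) = begin
      (a + b) · r +ₚ (0# ∷ (p +ₚ q) *ₚ r)
        ≈⟨ +ₚ-cong (·-distribʳ a b r) (∷-cong refl (*ₚ-distribʳ r p q)) ⟩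
      (a · r +ₚ b · r) +ₚ (0# ∷ p *ₚ r +ₚ q *ₚ r)
        ≈⟨ +ₚ-cong ≈ₚ-refl (0∷-+ (p *ₚ r) (q *ₚ r)) ⟩
      (a · r +ₚ b · r) +ₚ ((0# ∷ p *ₚ r) +ₚ (0# ∷ q *ₚ r))
        ≈⟨ +ₚ-interchange (a · r) (b · r) (0# ∷ p *ₚ r) (0# ∷ q *ₚ r) ⟩
      (a · r +ₚ (0# ∷ p *ₚ r)) +ₚ (b · r +ₚ (0# ∷ q *ₚ r)) ∎

    *ₚ-distribˡ : ∀ r p q → r *ₚ (p +ₚ q) ≈ₚ r *ₚ p +ₚ r *ₚ q
    *ₚ-distribˡ r p q = begin
      r *ₚ (p +ₚ q)       ≈⟨ *ₚ-comm r (p +ₚ q) ⟩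
      (p +ₚ q) *ₚ r       ≈⟨ *ₚ-distribʳ r p q ⟩
      p *ₚ r +ₚ q *ₚ r    ≈⟨ +ₚ-cong (*ₚ-comm p r) (*ₚ-comm q r) ⟩
      r *ₚ p +ₚ r *ₚ q    ∎

    ·-*ₚ : ∀ a q r → (a · q) *ₚ r ≈ₚ a · (q *ₚ r)
    ·-*ₚ a []      r = ≈ₚ-refl
    ·-*ₚ a (b ∷ q) r = begin
      (a * b) · r +ₚ (0# ∷ (a · q) *ₚ r)
        ≈⟨ +ₚ-cong (·-assoc a b r) (∷-cong (sym (zeroʳ a)) (·-*ₚ a q r)) ⟩
      a · (b · r) +ₚ a · (0# ∷ q *ₚ r)
        ≈⟨ ·-distribˡ a (b · r) (0# ∷ q *ₚ r) ⟨
      a · (b · r +ₚ (0# ∷ q *ₚ r)) ∎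

    *ₚ-assoc : ∀ p q r → (p *ₚ q) *ₚ r ≈ₚ p *ₚ (q *ₚ r)
    *ₚ-assoc []      q r = ≈ₚ-refl
    *ₚ-assoc (a ∷ p) q r = begin
      (a · q +ₚ (0# ∷ p *ₚ q)) *ₚ r
        ≈⟨ *ₚ-distribʳ r (a · q) (0# ∷ p *ₚ q) ⟩
      (a · q) *ₚ r +ₚ (0# ∷ p *ₚ q) *ₚ r
        ≈⟨ +ₚ-cong (·-*ₚ a q r) (0∷-* (p *ₚ q) r refl) ⟩
      a · (q *ₚ r) +ₚ (0# ∷ (p *ₚ q) *ₚ r)
        ≈⟨ +ₚ-cong ≈ₚ-refl (∷-cong refl (*ₚ-assoc p q r)) ⟩
      a · (q *ₚ r) +ₚ (0# ∷ p *ₚ (q *ₚ r)) ∎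

    *ₚ-identityˡ : ∀ p → const 1# *ₚ p ≈ₚ p
    *ₚ-identityˡ p = begin
      1# · p +ₚ (0# ∷ [])  ≈⟨ +ₚ-cong (1·-identity p) (∷-zero refl ≈ₚ-refl) ⟩
      p +ₚ []              ≈⟨ +ₚ-identityʳ p ⟩
      p                    ∎

    ₚ-isCommutativeRing : IsCommutativeRing _≈ₚ_ _+ₚ_ _*ₚ_ -ₚ_ [] (const 1#)
    ₚ-isCommutativeRing = record
      { isRing = record
        { +-isAbelianGroup = record
          { isGroup = record
            { isMonoid = record
              { isSemigroup = record
                { isMagma = record
                  { isEquivalence = ≈ₚ-isEquivalence
                  ; ∙-cong        = +ₚ-cong
                  }
                ; assoc = +ₚ-assoc
                }
              ; identity = (λ p → ≈ₚ-refl) , +ₚ-identityʳ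
              }
            ; inverse = +ₚ-inverseˡ
                      , λ p → ≈ₚ-trans (+ₚ-comm p (-ₚ p)) (+ₚ-inverseˡ p)
            ; ⁻¹-cong = -ₚ-cong
            }
          ; comm = +ₚ-comm
          }
        ; *-cong     = *ₚ-cong
        ; *-assoc    = *ₚ-assoc
        ; *-identity = *ₚ-identityˡ
                     , λ p → ≈ₚ-trans (*ₚ-comm p (const 1#)) (*ₚ-identityˡ p)
        ; distrib    = *ₚ-distribˡ , *ₚ-distribʳ
        }
      ; *-comm = *ₚ-comm
      }

    tail-zero : ∀ {a p} → (a ∷ p) ≈ₚ [] → p ≈ₚ []
    tail-zero e = mk≈ λ i → coeff≈ e (suc i)

    integralₚ : ∀ p q → p *ₚ q ≈ₚ [] → p ≈ₚ [] ⊎ q ≈ₚ []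
    integralₚ []      q       e = inj₁ ≈ₚ-refl
    integralₚ (a ∷ p) []      e = inj₂ ≈ₚ-refl
    integralₚ (a ∷ p) (b ∷ q) e =
      [ (λ a≈0 → Sum.map₁ (∷-zero a≈0)
          (integralₚ p (b ∷ q)
            (tail-zero (≈ₚ-trans (≈ₚ-sym (0∷-* p (b ∷ q) a≈0)) e))))
      , (λ b≈0 → Sum.map₂ (∷-zero b≈0)
          (integralₚ (a ∷ p) q
            (≈ₚ-trans (*ₚ-comm (a ∷ p) q)
              (tail-zero (≈ₚ-trans (≈ₚ-sym (0∷-* q (a ∷ p) b≈0))
                (≈ₚ-trans (*ₚ-comm (b ∷ q) (a ∷ p)) e))))))
      ]′ (integral a b (trans (sym (+-identityʳ (a * b))) (coeff≈ e 0)))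

  integralDomain : IntegralDomain c ℓ
  integralDomain = record
    { commutativeRing = record { isCommutativeRing = ₚ-isCommutativeRing }
    ; 1≉0             = λ e → 1≉0 (coeff≈ e 0)
    ; integral        = integralₚ
    }

------------------------------------------------------------------------
-- The field of fractions

module Fractions {c ℓ} (D : IntegralDomain c ℓ) where
  open IntegralDomain D
  open SemiringSolver commutativeSemiring using (solve; _:=_; _:+_; _:*_; con)
  open SetoidReasoning setoid

  record Frac : Set (c ⊔ ℓ) where
    constructor frac
    field
      num   : Carrier
      den   : Carrier
      den≉0 : ¬ den ≈ 0#
  open Frac public

  infix 4 _≈ᶠ_
  record _≈ᶠ_ (a b : Frac) : Set ℓ where
    constructor mk≈
    field cross : num a * den b ≈ num b * den a
  open _≈ᶠ_ public

  infixl 6 _+ᶠ_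
  infixl 7 _*ᶠ_ _÷ᶠ_[_]
  infix  8 -ᶠ_

  _+ᶠ_ : Frac → Frac → Frac
  frac a b b≉0 +ᶠ frac c d d≉0 = frac (a * d + c * b) (b * d) (*-≉0 b≉0 d≉0)

  _*ᶠ_ : Frac → Frac → Frac
  frac a b b≉0 *ᶠ frac c d d≉0 = frac (a * c) (b * d) (*-≉0 b≉0 d≉0)

  -ᶠ_ : Frac → Frac
  -ᶠ frac a b b≉0 = frac (- a) b b≉0

  fromD : Carrier → Frac
  fromD a = frac a 1# 1≉0

  0ᶠ 1ᶠ : Frac
  0ᶠ = fromD 0#
  1ᶠ = fromD 1#

  private
    num≉0 : ∀ {x} → ¬ x ≈ᶠ 0ᶠ → ¬ num x ≈ 0#
    num≉0 {frac a b _} x≉0 a≈0 =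
      x≉0 (mk≈ (trans (*-identityʳ a) (trans a≈0 (sym (zeroˡ b)))))

  _÷ᶠ_[_] : Frac → (x : Frac) → ¬ x ≈ᶠ 0ᶠ → Frac
  frac a b b≉0 ÷ᶠ x@(frac c d d≉0) [ x≉0 ] =
    frac (a * d) (b * c) (*-≉0 b≉0 (num≉0 x≉0))

  private
    ≈ᶠ-trans : ∀ {x y z} → x ≈ᶠ y → y ≈ᶠ z → x ≈ᶠ z
    ≈ᶠ-trans {frac a b _} {frac c d d≉0} {frac e f _} (mk≈ ad≈cb) (mk≈ cf≈ed) =
      mk≈ (*-cancelˡ d≉0 (begin
        d * (a * f)  ≈⟨ solve 3 (λ d a f → d :* (a :* f) := (a :* d) :* f) refl d a f ⟩
        (a * d) * f  ≈⟨ *-congʳ ad≈cb ⟩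
        (c * b) * f  ≈⟨ solve 3 (λ c b f → (c :* b) :* f := (c :* f) :* b) refl c b f ⟩
        (c * f) * b  ≈⟨ *-congʳ cf≈ed ⟩
        (e * d) * b  ≈⟨ solve 3 (λ e d b → (e :* d) :* b := d :* (e :* b)) refl e d b ⟩
        d * (e * b)  ∎))

    ≈ᶠ-isEquivalence : IsEquivalence _≈ᶠ_
    ≈ᶠ-isEquivalence = record
      { refl  = mk≈ refl
      ; sym   = λ e → mk≈ (sym (cross e))
      ; trans = ≈ᶠ-trans
      }

    +ᶠ-cong : ∀ {x x′ y y′} → x ≈ᶠ x′ → y ≈ᶠ y′ → x +ᶠ y ≈ᶠ x′ +ᶠ y′
    +ᶠ-cong {frac a b _} {frac a′ b′ _} {frac c d _} {frac c′ d′ _}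
            (mk≈ e) (mk≈ f) = mk≈ (begin
      (a * d + c * b) * (b′ * d′)
        ≈⟨ solve 6 (λ a b c d b′ d′ → (a :* d :+ c :* b) :* (b′ :* d′)
             := (a :* b′) :* (d :* d′) :+ (c :* d′) :* (b :* b′)) refl a b c d b′ d′ ⟩
      (a * b′) * (d * d′) + (c * d′) * (b * b′)
        ≈⟨ +-cong (*-congʳ e) (*-congʳ f) ⟩
      (a′ * b) * (d * d′) + (c′ * d) * (b * b′)
        ≈⟨ solve 6 (λ a′ b c′ d b′ d′ →
             (a′ :* b) :* (d :* d′) :+ (c′ :* d) :* (b :* b′)
             := (a′ :* d′ :+ c′ :* b′) :* (b :* d)) refl a′ b c′ d b′ d′ ⟩
      (a′ * d′ + c′ * b′) * (b * d) ∎)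

    *ᶠ-cong : ∀ {x x′ y y′} → x ≈ᶠ x′ → y ≈ᶠ y′ → x *ᶠ y ≈ᶠ x′ *ᶠ y′
    *ᶠ-cong {frac a b _} {frac a′ b′ _} {frac c d _} {frac c′ d′ _}
            (mk≈ e) (mk≈ f) = mk≈ (begin
      (a * c) * (b′ * d′)
        ≈⟨ solve 4 (λ a c b′ d′ → (a :* c) :* (b′ :* d′)
             := (a :* b′) :* (c :* d′)) refl a c b′ d′ ⟩
      (a * b′) * (c * d′)
        ≈⟨ *-cong e f ⟩
      (a′ * b) * (c′ * d)
        ≈⟨ solve 4 (λ a′ b c′ d → (a′ :* b) :* (c′ :* d)
             := (a′ :* c′) :* (b :* d)) refl a′ b c′ d ⟩
      (a′ * c′) * (b * d) ∎)

    -ᶠ-cong : ∀ {x y} → x ≈ᶠ y → -ᶠ x ≈ᶠ -ᶠ y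
    -ᶠ-cong {frac a b _} {frac c d _} (mk≈ e) = mk≈ (begin
      - a * d    ≈⟨ RingProperties.-‿distribˡ-* ring a d ⟨
      - (a * d)  ≈⟨ -‿cong e ⟩
      - (c * b)  ≈⟨ RingProperties.-‿distribˡ-* ring c b ⟩
      - c * b    ∎)

    +ᶠ-assoc : ∀ x y z → (x +ᶠ y) +ᶠ z ≈ᶠ x +ᶠ (y +ᶠ z)
    +ᶠ-assoc (frac a b _) (frac c d _) (frac e f _) = mk≈
      (solve 6 (λ a b c d e f →
          ((a :* d :+ c :* b) :* f :+ e :* (b :* d)) :* (b :* (d :* f))
          := (a :* (d :* f) :+ (c :* f :+ e :* d) :* b) :* ((b :* d) :* f))
        refl a b c d e f)

    +ᶠ-comm : ∀ x y → x +ᶠ y ≈ᶠ y +ᶠ x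
    +ᶠ-comm (frac a b _) (frac c d _) = mk≈
      (solve 4 (λ a b c d → (a :* d :+ c :* b) :* (d :* b)
          := (c :* b :+ a :* d) :* (b :* d)) refl a b c d)

    +ᶠ-identityˡ : ∀ x → 0ᶠ +ᶠ x ≈ᶠ x
    +ᶠ-identityˡ (frac a b _) = mk≈
      (solve 2 (λ a b → (con 0 :* b :+ a :* con 1) :* b
          := a :* (con 1 :* b)) refl a b)

    +ᶠ-inverseˡ : ∀ x → -ᶠ x +ᶠ x ≈ᶠ 0ᶠ
    +ᶠ-inverseˡ (frac a b _) = mk≈ (begin
      (- a * b + a * b) * 1#  ≈⟨ *-identityʳ _ ⟩
      - a * b + a * b         ≈⟨ distribʳ b (- a) a ⟨
      (- a + a) * b           ≈⟨ *-congʳ (-‿inverseˡ a) ⟩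
      0# * b                  ≈⟨ zeroˡ b ⟩
      0#                      ≈⟨ zeroˡ (b * b) ⟨
      0# * (b * b)            ∎)

    *ᶠ-assoc : ∀ x y z → (x *ᶠ y) *ᶠ z ≈ᶠ x *ᶠ (y *ᶠ z)
    *ᶠ-assoc (frac a b _) (frac c d _) (frac e f _) = mk≈
      (solve 6 (λ a b c d e f → ((a :* c) :* e) :* (b :* (d :* f))
          := (a :* (c :* e)) :* ((b :* d) :* f)) refl a b c d e f)

    *ᶠ-comm : ∀ x y → x *ᶠ y ≈ᶠ y *ᶠ x
    *ᶠ-comm (frac a b _) (frac c d _) = mk≈
      (solve 4 (λ a b c d → (a :* c) :* (d :* b) := (c :* a) :* (b :* d))
        refl a b c d)

    *ᶠ-identityˡ : ∀ x → 1ᶠ *ᶠ x ≈ᶠ x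
    *ᶠ-identityˡ (frac a b _) = mk≈
      (solve 2 (λ a b → (con 1 :* a) :* b := a :* (con 1 :* b)) refl a b)

    *ᶠ-distribˡ : ∀ x y z → x *ᶠ (y +ᶠ z) ≈ᶠ x *ᶠ y +ᶠ x *ᶠ z
    *ᶠ-distribˡ (frac a b _) (frac c d _) (frac e f _) = mk≈
      (solve 6 (λ a b c d e f →
          (a :* (c :* f :+ e :* d)) :* ((b :* d) :* (b :* f))
          := ((a :* c) :* (b :* f) :+ (a :* e) :* (b :* d)) :* (b :* (d :* f)))
        refl a b c d e f)

    *ᶠ-distribʳ : ∀ x y z → (y +ᶠ z) *ᶠ x ≈ᶠ y *ᶠ x +ᶠ z *ᶠ x
    *ᶠ-distribʳ (frac a b _) (frac c d _) (frac e f _) = mk≈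
      (solve 6 (λ a b c d e f →
          ((c :* f :+ e :* d) :* a) :* ((d :* b) :* (f :* b))
          := ((c :* a) :* (f :* b) :+ (e :* a) :* (d :* b)) :* ((d :* f) :* b))
        refl a b c d e f)

    ᶠ-isCommutativeRing : IsCommutativeRing _≈ᶠ_ _+ᶠ_ _*ᶠ_ -ᶠ_ 0ᶠ 1ᶠ
    ᶠ-isCommutativeRing = record
      { isRing = record
        { +-isAbelianGroup = record
          { isGroup = record
            { isMonoid = record
              { isSemigroup = record
                { isMagma = record
                  { isEquivalence = ≈ᶠ-isEquivalence
                  ; ∙-cong        = +ᶠ-cong
                  }
                ; assoc = +ᶠ-assoc
                }
              ; identity = +ᶠ-identityˡ
                         , λ x → ≈ᶠ-trans (+ᶠ-comm x 0ᶠ) (+ᶠ-identityˡ x)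
              }
            ; inverse = +ᶠ-inverseˡ
                      , λ x → ≈ᶠ-trans (+ᶠ-comm x (-ᶠ x)) (+ᶠ-inverseˡ x)
            ; ⁻¹-cong = -ᶠ-cong
            }
          ; comm = +ᶠ-comm
          }
        ; *-cong     = *ᶠ-cong
        ; *-assoc    = *ᶠ-assoc
        ; *-identity = *ᶠ-identityˡ
                     , λ x → ≈ᶠ-trans (*ᶠ-comm x 1ᶠ) (*ᶠ-identityˡ x)
        ; distrib    = *ᶠ-distribˡ , *ᶠ-distribʳ
        }
      ; *-comm = *ᶠ-comm
      }

    num-zero : ∀ {x} → num x ≈ 0# → x ≈ᶠ 0ᶠ
    num-zero {frac a b _} a≈0 =
      mk≈ (trans (*-identityʳ a) (trans a≈0 (sym (zeroˡ b))))

    zero-num : ∀ {x} → x ≈ᶠ 0ᶠ → num x ≈ 0#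
    zero-num {frac a b _} (mk≈ e) =
      trans (sym (*-identityʳ a)) (trans e (zeroˡ b))

    integralᶠ : ∀ x y → x *ᶠ y ≈ᶠ 0ᶠ → x ≈ᶠ 0ᶠ ⊎ y ≈ᶠ 0ᶠ
    integralᶠ x@(frac a b _) y@(frac c d _) e
      with integral a c (zero-num {x *ᶠ y} e)
    ... | inj₁ a≈0 = inj₁ (num-zero a≈0)
    ... | inj₂ c≈0 = inj₂ (num-zero c≈0)

  fromD≉0 : ∀ {a} → ¬ a ≈ 0# → ¬ fromD a ≈ᶠ 0ᶠ
  fromD≉0 a≉0 e = a≉0 (zero-num e)

  integralDomain : IntegralDomain (c ⊔ ℓ) ℓ
  integralDomain = record
    { commutativeRing = record { isCommutativeRing = ᶠ-isCommutativeRing }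
    ; 1≉0             = fromD≉0 1≉0
    ; integral        = integralᶠ
    }

  ÷ᶠ-spec : ∀ x y (y≉0 : ¬ y ≈ᶠ 0ᶠ) → (x ÷ᶠ y [ y≉0 ]) *ᶠ y ≈ᶠ x
  ÷ᶠ-spec (frac a b _) (frac c d _) y≉0 = mk≈
    (solve 4 (λ a b c d → ((a :* d) :* c) :* b := a :* ((b :* c) :* d))
      refl a b c d)

------------------------------------------------------------------------
-- The field of rational functions ℚ(y,t)

module ℚ[y] = Polynomial ℚ-integralDomain
module ℚ[y][t] = Polynomial ℚ[y].integralDomain
module Frac-ℚ[y][t] = Fractions ℚ[y][t].integralDomain

module ℚ⟨y,t⟩ where
  open Frac-ℚ[y][t] public using (fromD) renaming (_÷ᶠ_[_] to _÷_[_])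
  open IntegralDomain Frac-ℚ[y][t].integralDomain public
  open Enumerators commutativeRing public

  y t : Carrier
  y = fromD (ℚ[y][t].const ℚ[y].X)
  t = fromD ℚ[y][t].X

  y+t²≉0 : ¬ y + t ^ 2 ≈ 0#
  y+t²≉0 e with ℚ[y].coeff≈ (ℚ[y][t].coeff≈ (Frac-ℚ[y][t].cross e) 2) 0
  ... | ()

  1+yt≉0 : ¬ 1# + y * t ≈ 0#
  1+yt≉0 e with ℚ[y].coeff≈ (ℚ[y][t].coeff≈ (Frac-ℚ[y][t].cross e) 0) 0
  ... | ()

  1+yt²≉0 : ¬ 1# + y * t ^ 2 ≈ 0#
  1+yt²≉0 e with ℚ[y].coeff≈ (ℚ[y][t].coeff≈ (Frac-ℚ[y][t].cross e) 0) 0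
  ... | ()

  y+t≉0 : ¬ y + t ≈ 0#
  y+t≉0 e with ℚ[y].coeff≈ (ℚ[y][t].coeff≈ (Frac-ℚ[y][t].cross e) 1) 0
  ... | ()

-- Group the signed permutations π by σ = |π₁|⋯|πₙ|. Whether position i is a
-- descent of π depends only on whether i is a descent of σ and on the sign of
-- the letter that is larger in absolute value, so summing y^neg t^fdes over the
-- 2ⁿ choices of signs gives a product of one factor per letter that depends only
-- on the descent pattern of σ.
-- The statistics on the right-hand side do not match this product for σ itself:
-- lpk treats the left end of a word as preceded by an ascent, while in the
-- product the right end of σ behaves as if followed by one. They do match for the
-- reverse-complement of σ, whose descent pattern is that of σ read backwards.
module Submission where

open import Defs
open import Algebra.Bundles using (CommutativeRing)
import Algebra.Properties.CommutativeSemigroup as CommutativeSemigroupProperties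
import Algebra.Properties.Semiring.Exp as Exp
import Algebra.Solver.Ring.NaturalCoefficients.Default as SemiringSolver
open import Data.Bool.Base using (Bool; true; false; if_then_else_; _∧_; not)
import Data.Bool.Properties as Bool
open import Data.Integer.Base as ℤ using (ℤ; +_; -[1+_]; 0ℤ; ∣_∣)
import Data.Integer.Properties as ℤ
open import Data.List.Base
  using (List; []; _∷_; _++_; _∷ʳ_; map; filter; length; reverse; upTo; applyUpTo;
         applyDownFrom; cartesianProductWith)
import Data.List.Properties as List
open import Data.List.Membership.Propositional using (_∈_)
open import Data.List.Membership.Propositional.Properties using (∈-map⁻; ∈-map⁺; ∈-++⁺ʳ)
open import Data.List.Relation.Binary.Disjoint.Propositional using (Disjoint)
open import Data.List.Relation.Binary.Permutation.Propositional using (_↭_; ↭-sym; ↭⇒↭ₛ)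
open import Data.List.Relation.Binary.Permutation.Propositional.Properties using (↭-reverse)
import Data.List.Relation.Binary.Permutation.Setoid.Properties as Permutation
open import Data.List.Relation.Unary.All as All using (All; []; _∷_)
import Data.List.Relation.Unary.All.Properties as All
open import Data.List.Relation.Unary.AllPairs as AllPairs using (AllPairs; []; _∷_)
import Data.List.Relation.Unary.AllPairs.Properties as AllPairs
open import Data.List.Relation.Unary.Any using (here; there)
open import Data.List.Relation.Unary.Any.Properties using (reverse⁺; reverse⁻)
open import Data.List.Relation.Unary.Unique.DecPropositional ℤ._≟_
  using () renaming (unique? to uniqueℤ?)
open import Data.List.Relation.Unary.Unique.Propositional using (Unique)
import Data.List.Relation.Unary.Unique.Propositional.Properties as Unique
open import Data.Nat.Base as ℕ using (ℕ; zero; suc; _≤_; _≥_; _∸_; s≤s; z≤n)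
import Data.Nat.Properties as ℕ
open import Data.List.Relation.Unary.Unique.DecPropositional ℕ._≟_
  using () renaming (unique? to uniqueℕ?)
open import Data.Product.Base using (_×_; _,_)
open import Data.Sum.Base using (inj₁; inj₂)
open import Function.Base using (_∘_; flip)
open import Function.Bundles using (mk⇔)
open import Relation.Binary.PropositionalEquality.Core as ≡ using (_≡_; _≢_)
open import Relation.Binary.PropositionalEquality.Properties using (setoid; module ≡-Reasoning)
import Relation.Binary.Reasoning.Setoid as SetoidReasoning
open import Relation.Nullary.Decidable using (does; does-⇔; dec-false; ¬?)
open import Relation.Nullary.Negation using (¬_; contradiction)
open import Relation.Unary using (Decidable)

-- Descent patterns

descents : List ℕ → List Bool
descents (a ∷ b ∷ w) = does (b ℕ.<? a) ∷ descents (b ∷ w)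
descents _           = []

count : List Bool → ℕ
count []      = 0
count (d ∷ p) = (if d then 1 else 0) ℕ.+ count p

adjacent : (Bool → Bool → Bool) → List Bool → ℕ
adjacent r (c ∷ d ∷ p) = (if r c d then 1 else 0) ℕ.+ adjacent r (d ∷ p)
adjacent r _           = 0

-- `true` marks a descent, so an ascent followed by a descent is a peak, and `flip upDown` detects
-- valleys.
upDown : Bool → Bool → Bool
upDown c d = not c ∧ d

length-descents : ∀ a w → length (descents (a ∷ w)) ≡ length w
length-descents a []      = ≡.refl
length-descents a (b ∷ w) = ≡.cong suc (length-descents b w)

des≡ : ∀ w → des w ≡ count (descents w)
des≡ []          = ≡.refl
des≡ (a ∷ [])    = ≡.refl
des≡ (a ∷ b ∷ w) = ≡.cong (_ ℕ.+_) (des≡ (b ∷ w))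

-- `pk` and `val` also test ascents, while a pattern records only descents. For distinct letters
-- each test negates the other, which is why the lemmas on peaks and valleys assume uniqueness.
does-<?-flip : ∀ {a b} → a ≢ b → does (a ℕ.<? b) ≡ not (does (b ℕ.<? a))
does-<?-flip {a} {b} a≢b = does-⇔
  (mk⇔ ℕ.<-asym λ b≮a → ℕ.≤∧≢⇒< (ℕ.≮⇒≥ b≮a) a≢b)
  (a ℕ.<? b) (¬? (b ℕ.<? a))

pk≡ : ∀ {w} → Unique w → pk w ≡ adjacent upDown (descents w)
pk≡ {[]}            _ = ≡.refl
pk≡ {a ∷ []}        _ = ≡.refl
pk≡ {a ∷ b ∷ []}    _ = ≡.refl
pk≡ {a ∷ b ∷ c ∷ w} ((a≢b ∷ _) ∷ u) =
  ≡.cong₂ (λ d k → (if d ∧ does (c ℕ.<? b) then 1 else 0) ℕ.+ k)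
    (does-<?-flip a≢b) (pk≡ u)

val≡ : ∀ {w} → Unique w → val w ≡ adjacent (flip upDown) (descents w)
val≡ {[]}            _ = ≡.refl
val≡ {a ∷ []}        _ = ≡.refl
val≡ {a ∷ b ∷ []}    _ = ≡.refl
val≡ {a ∷ b ∷ c ∷ w} (_ ∷ u@((b≢c ∷ _) ∷ _)) =
  ≡.cong₂ (λ d k → (if d then 1 else 0) ℕ.+ k)
    (≡.trans (≡.cong (does (b ℕ.<? a) ∧_) (does-<?-flip b≢c))
             (Bool.∧-comm (does (b ℕ.<? a)) _))
    (val≡ u)

-- The prepended `false` is a fictitious ascent into the first letter, so an initial descent counts
-- as a peak.
lpk≡ : ∀ {w} → Unique w → lpk w ≡ adjacent upDown (false ∷ descents w)
lpk≡ {[]}        _ = ≡.refl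
lpk≡ {a ∷ []}    _ = ≡.refl
lpk≡ {a ∷ b ∷ w} u = ≡.cong (_ ℕ.+_) (pk≡ u)

open CommutativeSemigroupProperties ℕ.+-commutativeSemigroup
  using () renaming (x∙yz≈y∙xz to m+[n+o]≡n+[m+o])

count-∷ʳ : ∀ p d → count (p ∷ʳ d) ≡ count (d ∷ p)
count-∷ʳ []      d = ≡.refl
count-∷ʳ (c ∷ p) d = begin
  ⟦ c ⟧ ℕ.+ count (p ∷ʳ d)      ≡⟨ ≡.cong (⟦ c ⟧ ℕ.+_) (count-∷ʳ p d) ⟩
  ⟦ c ⟧ ℕ.+ (⟦ d ⟧ ℕ.+ count p) ≡⟨ m+[n+o]≡n+[m+o] ⟦ c ⟧ ⟦ d ⟧ (count p) ⟩
  ⟦ d ⟧ ℕ.+ (⟦ c ⟧ ℕ.+ count p) ∎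
  where
  open ≡-Reasoning
  ⟦_⟧ : Bool → ℕ
  ⟦ b ⟧ = if b then 1 else 0

count-reverse : ∀ p → count (reverse p) ≡ count p
count-reverse []      = ≡.refl
count-reverse (d ∷ p) = begin
  count (reverse (d ∷ p))  ≡⟨ ≡.cong count (List.unfold-reverse d p) ⟩
  count (reverse p ∷ʳ d)   ≡⟨ count-∷ʳ (reverse p) d ⟩
  count (d ∷ reverse p)    ≡⟨ ≡.cong (_ ℕ.+_) (count-reverse p) ⟩
  count (d ∷ p)            ∎
  where open ≡-Reasoning

adjacent-∷ʳ : ∀ r p c d →
  adjacent r (p ∷ʳ c ∷ʳ d) ≡ (if r c d then 1 else 0) ℕ.+ adjacent r (p ∷ʳ c)
adjacent-∷ʳ r []          c d = ≡.refl
adjacent-∷ʳ r (a ∷ [])    c d = m+[n+o]≡n+[m+o] (if r a c then 1 else 0) (if r c d then 1 else 0) 0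
adjacent-∷ʳ r (a ∷ b ∷ p) c d = ≡.trans
  (≡.cong (_ ℕ.+_) (adjacent-∷ʳ r (b ∷ p) c d))
  (m+[n+o]≡n+[m+o] (if r a b then 1 else 0) (if r c d then 1 else 0) _)

reverse-∷∷ : ∀ {a} {A : Set a} (x y : A) xs →
  reverse (x ∷ y ∷ xs) ≡ reverse xs ∷ʳ y ∷ʳ x
reverse-∷∷ x y xs = ≡.trans (List.unfold-reverse x (y ∷ xs))
  (≡.cong (_∷ʳ x) (List.unfold-reverse y xs))

adjacent-reverse : ∀ r p → adjacent r (reverse p) ≡ adjacent (flip r) p
adjacent-reverse r []          = ≡.refl
adjacent-reverse r (c ∷ [])    = ≡.refl
adjacent-reverse r (c ∷ d ∷ p) = begin
  adjacent r (reverse (c ∷ d ∷ p))      ≡⟨ ≡.cong (adjacent r) (reverse-∷∷ c d p) ⟩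
  adjacent r (reverse p ∷ʳ d ∷ʳ c)      ≡⟨ adjacent-∷ʳ r (reverse p) d c ⟩
  _ ℕ.+ adjacent r (reverse p ∷ʳ d)     ≡⟨ ≡.cong (λ v → _ ℕ.+ adjacent r v) (List.unfold-reverse d p) ⟨
  _ ℕ.+ adjacent r (reverse (d ∷ p))    ≡⟨ ≡.cong (_ ℕ.+_) (adjacent-reverse r (d ∷ p)) ⟩
  adjacent (flip r) (c ∷ d ∷ p)         ∎
  where open ≡-Reasoning

descents-∷ʳ : ∀ w a b → descents (w ∷ʳ a ∷ʳ b) ≡ descents (w ∷ʳ a) ∷ʳ does (b ℕ.<? a)
descents-∷ʳ []          a b = ≡.refl
descents-∷ʳ (c ∷ [])    a b = ≡.refl
descents-∷ʳ (c ∷ d ∷ w) a b = ≡.cong (_ ∷_) (descents-∷ʳ (d ∷ w) a b)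

-- The reverse-complement

Letter : ℕ → ℕ → Set
Letter n k = 1 ≤ k × k ≤ n

complement : ℕ → ℕ → ℕ
complement n k = suc n ∸ k

reverseComplement : ℕ → List ℕ → List ℕ
reverseComplement n w = reverse (map (complement n) w)

does-complement : ∀ {n a b} → Letter n a → Letter n b →
  does (complement n a ℕ.<? complement n b) ≡ does (b ℕ.<? a)
does-complement {n} {a} {b} (_ , a≤n) (_ , b≤n) = does-⇔
  (mk⇔ (λ lt → ℕ.≰⇒> λ a≤b → ℕ.<⇒≱ lt (ℕ.∸-monoʳ-≤ (suc n) a≤b))
       (λ b<a → ℕ.∸-monoʳ-< b<a (ℕ.m≤n⇒m≤1+n a≤n)))
  (complement n a ℕ.<? complement n b) (b ℕ.<? a)

-- Reversal alone would also exchange ascents and descents; complementing the letters exchanges them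
-- back.
descents-reverseComplement : ∀ {n w} → All (Letter n) w →
  descents (reverseComplement n w) ≡ reverse (descents w)
descents-reverseComplement []       = ≡.refl
descents-reverseComplement (_ ∷ []) = ≡.refl
descents-reverseComplement {n} {a ∷ b ∷ w} (a∈ ∷ b∈ ∷ w∈) = begin
  descents (reverse (c a ∷ c b ∷ map c w))
    ≡⟨ ≡.cong descents (reverse-∷∷ (c a) (c b) (map c w)) ⟩
  descents (reverse (map c w) ∷ʳ c b ∷ʳ c a)
    ≡⟨ descents-∷ʳ (reverse (map c w)) (c b) (c a) ⟩
  descents (reverse (map c w) ∷ʳ c b) ∷ʳ does (c a ℕ.<? c b)
    ≡⟨ ≡.cong₂ (λ v d → descents v ∷ʳ d)
         (≡.sym (List.unfold-reverse (c b) (map c w))) (does-complement a∈ b∈) ⟩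
  descents (reverse (map c (b ∷ w))) ∷ʳ does (b ℕ.<? a)
    ≡⟨ ≡.cong (_∷ʳ does (b ℕ.<? a)) (descents-reverseComplement (b∈ ∷ w∈)) ⟩
  reverse (descents (b ∷ w)) ∷ʳ does (b ℕ.<? a)
    ≡⟨ List.unfold-reverse (does (b ℕ.<? a)) (descents (b ∷ w)) ⟨
  reverse (descents (a ∷ b ∷ w)) ∎
  where
  open ≡-Reasoning
  c = complement n

complement-involutive : ∀ {n w} → All (Letter n) w →
  map (complement n) (map (complement n) w) ≡ w
complement-involutive []                 = ≡.refl
complement-involutive ((_ , a≤n) ∷ w∈) =
  ≡.cong₂ _∷_ (ℕ.m∸[m∸n]≡n (ℕ.m≤n⇒m≤1+n a≤n)) (complement-involutive w∈)

Unique-resp-↭ : ∀ {A : Set} {xs ys : List A} → xs ↭ ys → Unique xs → Unique ys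
Unique-resp-↭ {A} p = Permutation.Unique-resp-↭ (setoid A) (↭⇒↭ₛ p)

Unique-reverse⁺ : ∀ {A : Set} {xs : List A} → Unique xs → Unique (reverse xs)
Unique-reverse⁺ {xs = xs} = Unique-resp-↭ (↭-sym (↭-reverse xs))

Unique-reverse⁻ : ∀ {A : Set} {xs : List A} → Unique (reverse xs) → Unique xs
Unique-reverse⁻ {xs = xs} = Unique-resp-↭ (↭-reverse xs)

-- Complementing twice gives back `w`, so a repetition in the complement would reappear in `w`.
Unique-reverseComplement⁺ : ∀ {n w} → All (Letter n) w →
  Unique w → Unique (reverseComplement n w)
Unique-reverseComplement⁺ w∈ u =
  Unique-reverse⁺ (Unique.map⁻ (≡.subst Unique (≡.sym (complement-involutive w∈)) u))

Unique-reverseComplement⁻ : ∀ {n w} → Unique (reverseComplement n w) → Unique w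
Unique-reverseComplement⁻ = Unique.map⁻ ∘ Unique-reverse⁻

-- Words over an alphabet

words-All : ∀ {A : Set} {P : A → Set} {alphabet} → All P alphabet →
  ∀ n → All (All P) (words alphabet n)
words-All                         P-alphabet zero    = [] ∷ []
words-All {A} {alphabet = alphabet} P-alphabet (suc n) =
  All.cartesianProductWith⁺ (setoid A) (setoid (List A)) _∷_ alphabet (words alphabet n)
    λ x∈ w∈ → All.lookup P-alphabet x∈ ∷ All.lookup (words-All P-alphabet n) w∈

words-length : ∀ {A : Set} (alphabet : List A) n →
  All (λ w → length w ≡ n) (words alphabet n)
words-length alphabet zero    = ≡.refl ∷ []
words-length {A} alphabet (suc n) =
  All.cartesianProductWith⁺ (setoid A) (setoid (List A)) _∷_ alphabet (words alphabet n)
    λ _ w∈ → ≡.cong suc (All.lookup (words-length alphabet n) w∈)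

letters : ∀ n → All (Letter n) (map suc (upTo n))
letters n = All.map⁺ (All.applyUpTo⁺₁ _ n λ i<n → s≤s z≤n , i<n)

𝔖-All : ∀ n → All (λ w → All (Letter n) w × length w ≡ n × Unique w) (𝔖 n)
𝔖-All n = All.zip (All.filter⁺ uniqueℕ? (words-All (letters n) n) ,
  All.zip (All.filter⁺ uniqueℕ? (words-length (map suc (upTo n)) n) ,
           All.all-filter uniqueℕ? (words (map suc (upTo n)) n)))

-- Symmetric words

AllPairs-≢⁻ : ∀ {A B : Set} {f : A → B} {xs x y} → AllPairs (λ x y → f x ≢ f y) xs →
  x ∈ xs → y ∈ xs → f x ≡ f y → x ≡ y
AllPairs-≢⁻ (_ ∷ _)  (here ≡.refl) (here ≡.refl) _ = ≡.refl
AllPairs-≢⁻ (h ∷ _)  (here ≡.refl) (there y∈) e = contradiction e (All.lookup h y∈)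
AllPairs-≢⁻ (h ∷ _)  (there x∈) (here ≡.refl) e = contradiction (≡.sym e) (All.lookup h x∈)
AllPairs-≢⁻ (_ ∷ hs) (there x∈) (there y∈) e = AllPairs-≢⁻ hs x∈ y∈ e

-- Injectivity is asked for on members of `xs` only, because `∣_∣` is not injective on all of ℤ.
AllPairs-≢⁺ : ∀ {A B : Set} {f : A → B} {xs} → Unique xs →
  (∀ {x y} → x ∈ xs → y ∈ xs → f x ≡ f y → x ≡ y) → AllPairs (λ x y → f x ≢ f y) xs
AllPairs-≢⁺ []       inj = []
AllPairs-≢⁺ (h ∷ hs) inj =
  All.tabulate (λ y∈ e → All.lookup h y∈ (inj (here ≡.refl) (there y∈) e))
  ∷ AllPairs-≢⁺ hs λ x∈ y∈ → inj (there x∈) (there y∈)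

negations : List ℤ → List ℤ
negations w = reverse (map ℤ.-_ w)

∈-negations⁺ : ∀ {w a} → a ∈ w → ℤ.- a ∈ negations w
∈-negations⁺ a∈w = reverse⁺ (∈-map⁺ ℤ.-_ a∈w)

i≡-i⇒i≡0 : ∀ {i} → i ≡ ℤ.- i → i ≡ 0ℤ
i≡-i⇒i≡0 {+ 0}     _ = ≡.refl
i≡-i⇒i≡0 {+ suc _} ()

symmetric-unique⁺ : ∀ {w} → All (_≢ 0ℤ) w → Unique (map ∣_∣ w) → Unique (symmetricWord w)
symmetric-unique⁺ {w} w≢0 u = Unique.++⁺
  (Unique-reverse⁺ (Unique.map⁺ ℤ.neg-injective (Unique.map⁻ u)))
  (All.map ≡.≢-sym w≢0 ∷ Unique.map⁻ u)
  disjoint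
  where
  u′ : AllPairs (λ x y → ∣ x ∣ ≢ ∣ y ∣) w
  u′ = AllPairs.map⁻ u

  disjoint : Disjoint (negations w) (0ℤ ∷ w)
  disjoint (x∈ , y∈) with ∈-map⁻ ℤ.-_ (reverse⁻ x∈) | y∈
  ... | a , a∈w , e | here x≡0 =
    All.lookup w≢0 a∈w (ℤ.neg-injective (≡.trans (≡.sym e) x≡0))
  -- Here `a` and its negative are both letters of `w` with the same absolute value; they must
  -- coincide, which forces `a` to be 0.
  ... | a , a∈w , ≡.refl | there -a∈w =
    All.lookup w≢0 a∈w (i≡-i⇒i≡0 (AllPairs-≢⁻ u′ a∈w -a∈w (≡.sym (ℤ.∣-i∣≡∣i∣ a))))

Unique-++⁻ʳ : ∀ {A : Set} (xs : List A) {ys} → Unique (xs ++ ys) → Unique ys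
Unique-++⁻ʳ []       u       = u
Unique-++⁻ʳ (x ∷ xs) (_ ∷ u) = Unique-++⁻ʳ xs u

Unique-++⇒Disjoint : ∀ {A : Set} {xs ys : List A} → Unique (xs ++ ys) → Disjoint xs ys
Unique-++⇒Disjoint {xs = _ ∷ xs} (h ∷ _) (here ≡.refl , y∈) =
  All.lookup h (∈-++⁺ʳ xs y∈) ≡.refl
Unique-++⇒Disjoint (_ ∷ u) (there x∈ , y∈) = Unique-++⇒Disjoint u (x∈ , y∈)

-- Letters of equal absolute value are equal or opposite. In the opposite case one of them would
-- occur both in `negations w` and in `w`, that is, on both sides of the central 0.
symmetric-unique⁻ : ∀ {w} → Unique (symmetricWord w) → Unique (map ∣_∣ w)
symmetric-unique⁻ {w} u = AllPairs.map⁺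
  (AllPairs-≢⁺ (AllPairs.tail (Unique-++⁻ʳ (negations w) u)) ∣∣-injective)
  where
  ∣∣-injective : ∀ {a b} → a ∈ w → b ∈ w → ∣ a ∣ ≡ ∣ b ∣ → a ≡ b
  ∣∣-injective {a} {b} a∈w b∈w e with ℤ.+∣i∣≡i⊎+∣i∣≡-i a | ℤ.+∣i∣≡i⊎+∣i∣≡-i b
  ... | inj₁ p | inj₁ q = ≡.trans (≡.sym p) (≡.trans (≡.cong +_ e) q)
  ... | inj₂ p | inj₂ q = ℤ.neg-injective (≡.trans (≡.sym p) (≡.trans (≡.cong +_ e) q))
  ... | inj₁ p | inj₂ q = contradiction
    (∈-negations⁺ b∈w , there (≡.subst (_∈ w) (≡.trans (≡.sym p) (≡.trans (≡.cong +_ e) q)) a∈w))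
    (Unique-++⇒Disjoint u)
  ... | inj₂ p | inj₁ q = contradiction
    (∈-negations⁺ a∈w , there (≡.subst (_∈ w) (≡.trans (≡.sym q) (≡.trans (≡.cong +_ (≡.sym e)) p)) b∈w))
    (Unique-++⇒Disjoint u)

symmetric-unique⇒≢0 : ∀ {w} → Unique (symmetricWord w) → All (_≢ 0ℤ) w
symmetric-unique⇒≢0 {w} u = All.map ≡.≢-sym (AllPairs.head (Unique-++⁻ʳ (negations w) u))

-- The alphabets of 𝔖 and 𝔅

map-complement : ∀ n → map (complement n) (map suc (upTo n)) ≡ reverse (map suc (upTo n))
map-complement n = ≡.trans
  -- `complement n (suc i)` reduces to `n ∸ i`, so the complemented alphabet is n, n-1, ..., 1.
  (≡.trans (≡.sym (List.map-∘ (upTo n))) (≡.trans (List.map-upTo (n ∸_) n) (descending n)))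
  (≡.trans (≡.sym (List.reverse-applyUpTo suc n)) (≡.cong reverse (≡.sym (List.map-upTo suc n))))
  where
  descending : ∀ n → applyUpTo (n ∸_) n ≡ applyDownFrom suc n
  descending zero    = ≡.refl
  descending (suc n) = ≡.cong (suc n ∷_) (descending n)

integers : ℕ → List ℤ
integers n = map (λ k → + k ℤ.- + n) (upTo (suc (2 ℕ.* n)))

-- One new letter appears at each end, so the alphabet can be built up from 0 by adding pairs of
-- opposite letters.
integers-suc : ∀ n → integers (suc n) ≡ -[1+ n ] ∷ (integers n ∷ʳ + suc n)
integers-suc n = begin
  map f (upTo (suc (2 ℕ.* suc n)))
    ≡⟨ List.map-upTo f (suc (2 ℕ.* suc n)) ⟩
  -[1+ n ] ∷ applyUpTo (f ∘ suc) (2 ℕ.* suc n)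
    ≡⟨ ≡.cong (λ m → -[1+ n ] ∷ applyUpTo (f ∘ suc) m) (ℕ.*-suc 2 n) ⟩
  -[1+ n ] ∷ applyUpTo (f ∘ suc) (suc (suc (2 ℕ.* n)))
    ≡⟨ ≡.cong (-[1+ n ] ∷_) (List.applyUpTo-∷ʳ (f ∘ suc) (suc (2 ℕ.* n))) ⟨
  -[1+ n ] ∷ (applyUpTo (f ∘ suc) (suc (2 ℕ.* n)) ∷ʳ f (suc (suc (2 ℕ.* n))))
    ≡⟨ ≡.cong₂ (λ xs x → -[1+ n ] ∷ (xs ∷ʳ x)) init last ⟩
  -[1+ n ] ∷ (integers n ∷ʳ + suc n) ∎
  where
  open ≡-Reasoning
  f : ℕ → ℤ
  f k = + k ℤ.- + suc n

  shift : ∀ k → f (suc k) ≡ + k ℤ.- + n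
  shift k = ≡.trans (ℤ.[1+m]⊖[1+n]≡m⊖n k n) (≡.sym (ℤ.[+m]-[+n]≡m⊖n k n))

  init : applyUpTo (f ∘ suc) (suc (2 ℕ.* n)) ≡ integers n
  init = ≡.trans (≡.sym (List.map-upTo (f ∘ suc) _)) (List.map-cong shift (upTo (suc (2 ℕ.* n))))

  last : f (suc (suc (2 ℕ.* n))) ≡ + suc n
  last = begin
    f (suc (suc (2 ℕ.* n)))      ≡⟨ shift (suc (2 ℕ.* n)) ⟩
    + suc (2 ℕ.* n) ℤ.- + n      ≡⟨ ℤ.[+m]-[+n]≡m⊖n (suc (2 ℕ.* n)) n ⟩
    suc (2 ℕ.* n) ℤ.⊖ n          ≡⟨ ≡.cong (λ m → suc (n ℕ.+ m) ℤ.⊖ n) (ℕ.+-identityʳ n) ⟩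
    (suc n ℕ.+ n) ℤ.⊖ n          ≡⟨ ℤ.⊖-≥ (ℕ.m≤n+m n (suc n)) ⟩
    + ((suc n ℕ.+ n) ∸ n)        ≡⟨ ≡.cong +_ (ℕ.m+n∸n≡m (suc n) n) ⟩
    + suc n                      ∎

-- Sums over words

module Sums {c ℓ} (R : CommutativeRing c ℓ) where
  open CommutativeRing R hiding (zero)
  open Enumerators R using (Σ[_]_)
  open SetoidReasoning (CommutativeRing.setoid R)
  open CommutativeSemigroupProperties +-commutativeSemigroup
    using () renaming (interchange to +-interchange)

  Σ-cong : ∀ {A : Set} {xs : List A} {f g} → All (λ x → f x ≈ g x) xs → Σ[ xs ] f ≈ Σ[ xs ] g
  Σ-cong []       = refl
  Σ-cong (e ∷ es) = +-cong e (Σ-cong es)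

  Σ-cong′ : ∀ {A : Set} (xs : List A) {f g} → (∀ x → f x ≈ g x) → Σ[ xs ] f ≈ Σ[ xs ] g
  Σ-cong′ xs e = Σ-cong (All.universal e xs)

  Σ-≡ : ∀ {A : Set} {xs ys : List A} f → xs ≡ ys → Σ[ xs ] f ≈ Σ[ ys ] f
  Σ-≡ f ≡.refl = refl

  Σ-zero : ∀ {A : Set} (xs : List A) {f} → (∀ x → f x ≈ 0#) → Σ[ xs ] f ≈ 0#
  Σ-zero []       e = refl
  Σ-zero (x ∷ xs) e = trans (+-cong (e x) (Σ-zero xs e)) (+-identityˡ 0#)

  Σ-++ : ∀ {A : Set} (xs ys : List A) f → Σ[ xs ++ ys ] f ≈ Σ[ xs ] f + Σ[ ys ] f
  Σ-++ []       ys f = sym (+-identityˡ _)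
  Σ-++ (x ∷ xs) ys f = trans (+-congˡ (Σ-++ xs ys f)) (sym (+-assoc _ _ _))

  Σ-∷ʳ : ∀ {A : Set} (xs : List A) x f → Σ[ xs ∷ʳ x ] f ≈ Σ[ xs ] f + f x
  Σ-∷ʳ xs x f = trans (Σ-++ xs (x ∷ []) f) (+-congˡ (+-identityʳ (f x)))

  Σ-map : ∀ {A B : Set} (g : A → B) (xs : List A) f → Σ[ map g xs ] f ≈ Σ[ xs ] (f ∘ g)
  Σ-map g []       f = refl
  Σ-map g (x ∷ xs) f = +-congˡ (Σ-map g xs f)

  Σ-+ : ∀ {A : Set} (xs : List A) f g → Σ[ xs ] (λ x → f x + g x) ≈ Σ[ xs ] f + Σ[ xs ] g
  Σ-+ []       f g = sym (+-identityˡ 0#)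
  Σ-+ (x ∷ xs) f g = trans (+-congˡ (Σ-+ xs f g)) (+-interchange _ _ _ _)

  Σ-*ˡ : ∀ {A : Set} a (xs : List A) f → Σ[ xs ] (λ x → a * f x) ≈ a * Σ[ xs ] f
  Σ-*ˡ a []       f = sym (zeroʳ a)
  Σ-*ˡ a (x ∷ xs) f = trans (+-congˡ (Σ-*ˡ a xs f)) (sym (distribˡ a _ _))

  Σ-swap : ∀ {A B : Set} (xs : List A) (ys : List B) (f : A → B → Carrier) →
    Σ[ xs ] (λ x → Σ[ ys ] (λ y → f x y)) ≈ Σ[ ys ] (λ y → Σ[ xs ] (λ x → f x y))
  Σ-swap []       ys f = sym (Σ-zero ys λ _ → refl)
  Σ-swap (x ∷ xs) ys f =
    trans (+-congˡ (Σ-swap xs ys f)) (sym (Σ-+ ys (f x) λ y → Σ[ xs ] λ x → f x y))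

  Σ-filter : ∀ {A : Set} {P : A → Set} (P? : Decidable P) xs f →
    Σ[ filter P? xs ] f ≈ Σ[ xs ] λ x → if does (P? x) then f x else 0#
  Σ-filter P? []       f = refl
  Σ-filter P? (x ∷ xs) f with does (P? x)
  ... | true  = +-congˡ (Σ-filter P? xs f)
  ... | false = trans (Σ-filter P? xs f) (sym (+-identityˡ _))

  Σ-words-∷ : ∀ {A : Set} (alphabet : List A) n f →
    Σ[ words alphabet (suc n) ] f ≈ Σ[ alphabet ] λ a → Σ[ words alphabet n ] λ w → f (a ∷ w)
  Σ-words-∷ alphabet n f = go alphabet
    where
    go : ∀ xs → Σ[ cartesianProductWith _∷_ xs (words alphabet n) ] f
              ≈ Σ[ xs ] λ a → Σ[ words alphabet n ] λ w → f (a ∷ w)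
    go []       = refl
    go (x ∷ xs) = trans (Σ-++ (map (x ∷_) (words alphabet n)) _ f)
      (+-cong (Σ-map (x ∷_) (words alphabet n) f) (go xs))

  -- Needed because reversal carries the first letter to the end. The induction splits off both end
  -- letters and exchanges the two sums.
  Σ-words-∷ʳ : ∀ {A : Set} (alphabet : List A) n f →
    Σ[ words alphabet (suc n) ] f ≈ Σ[ alphabet ] λ a → Σ[ words alphabet n ] λ w → f (w ∷ʳ a)
  Σ-words-∷ʳ alphabet zero    f = Σ-words-∷ alphabet zero f
  Σ-words-∷ʳ alphabet (suc n) f = begin
    Σ[ words alphabet (suc (suc n)) ] f
      ≈⟨ Σ-words-∷ alphabet (suc n) f ⟩
    (Σ[ alphabet ] λ a → Σ[ words alphabet (suc n) ] λ w → f (a ∷ w))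
      ≈⟨ Σ-cong′ alphabet (λ a → Σ-words-∷ʳ alphabet n (f ∘ (a ∷_))) ⟩
    (Σ[ alphabet ] λ a → Σ[ alphabet ] λ b → Σ[ words alphabet n ] λ w → f (a ∷ w ∷ʳ b))
      ≈⟨ Σ-swap alphabet alphabet _ ⟩
    (Σ[ alphabet ] λ b → Σ[ alphabet ] λ a → Σ[ words alphabet n ] λ w → f (a ∷ w ∷ʳ b))
      ≈⟨ Σ-cong′ alphabet (λ b → Σ-words-∷ alphabet n (λ w → f (w ∷ʳ b))) ⟨
    (Σ[ alphabet ] λ b → Σ[ words alphabet (suc n) ] λ w → f (w ∷ʳ b)) ∎

  Σ-words-reverse-map : ∀ {A : Set} (alphabet : List A) (h : A → A) →
    (∀ g → Σ[ alphabet ] (g ∘ h) ≈ Σ[ alphabet ] g) → ∀ n f →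
    Σ[ words alphabet n ] (λ w → f (reverse (map h w))) ≈ Σ[ words alphabet n ] f
  Σ-words-reverse-map alphabet h invariant zero    f = refl
  Σ-words-reverse-map alphabet h invariant (suc n) f = begin
    (Σ[ words alphabet (suc n) ] λ w → f (reverse (map h w)))
      ≈⟨ Σ-words-∷ alphabet n _ ⟩
    (Σ[ alphabet ] λ a → Σ[ words alphabet n ] λ w → f (reverse (h a ∷ map h w)))
      ≈⟨ Σ-cong′ alphabet (λ a → Σ-cong′ (words alphabet n) λ w →
           reflexive (≡.cong f (List.unfold-reverse (h a) (map h w)))) ⟩
    (Σ[ alphabet ] λ a → Σ[ words alphabet n ] λ w → f (reverse (map h w) ∷ʳ h a))
      ≈⟨ Σ-cong′ alphabet (λ a → Σ-words-reverse-map alphabet h invariant n (λ w → f (w ∷ʳ h a))) ⟩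
    (Σ[ alphabet ] λ a → Σ[ words alphabet n ] λ w → f (w ∷ʳ h a))
      ≈⟨ invariant (λ a → Σ[ words alphabet n ] λ w → f (w ∷ʳ a)) ⟩
    (Σ[ alphabet ] λ a → Σ[ words alphabet n ] λ w → f (w ∷ʳ a))
      ≈⟨ Σ-words-∷ʳ alphabet n f ⟨
    Σ[ words alphabet (suc n) ] f ∎

  Σ-reverse : ∀ {A : Set} (xs : List A) f → Σ[ reverse xs ] f ≈ Σ[ xs ] f
  Σ-reverse []       f = refl
  Σ-reverse (x ∷ xs) f = begin
    Σ[ reverse (x ∷ xs) ] f    ≈⟨ Σ-≡ f (List.unfold-reverse x xs) ⟩
    Σ[ reverse xs ∷ʳ x ] f     ≈⟨ Σ-∷ʳ (reverse xs) x f ⟩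
    Σ[ reverse xs ] f + f x    ≈⟨ +-congʳ (Σ-reverse xs f) ⟩
    Σ[ xs ] f + f x            ≈⟨ +-comm _ _ ⟩
    Σ[ x ∷ xs ] f              ∎

  Σ-complement : ∀ n g → Σ[ map suc (upTo n) ] (g ∘ complement n) ≈ Σ[ map suc (upTo n) ] g
  Σ-complement n g = begin
    Σ[ map suc (upTo n) ] (g ∘ complement n)
      ≈⟨ Σ-map (complement n) (map suc (upTo n)) g ⟨
    Σ[ map (complement n) (map suc (upTo n)) ] g
      ≈⟨ Σ-≡ g (map-complement n) ⟩
    Σ[ reverse (map suc (upTo n)) ] g
      ≈⟨ Σ-reverse (map suc (upTo n)) g ⟩
    Σ[ map suc (upTo n) ] g ∎


  -- The filter defining `𝔖` is rewritten as an indicator, which the reverse-complement preserves.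
  -- The sum then runs over all words, where the letters vary independently and can be complemented
  -- one at a time.
  Σ-𝔖-reverseComplement : ∀ n f →
    Σ[ 𝔖 n ] (f ∘ reverseComplement n) ≈ Σ[ 𝔖 n ] f
  Σ-𝔖-reverseComplement n f = begin
    Σ[ 𝔖 n ] (f ∘ rc)
      ≈⟨ Σ-filter uniqueℕ? ws (f ∘ rc) ⟩
    (Σ[ ws ] λ w → if does (uniqueℕ? w) then f (rc w) else 0#)
      ≈⟨ Σ-cong (All.map (λ {w} w∈ → reflexive (≡.cong (λ b → if b then f (rc w) else 0#)
           (does-⇔ (mk⇔ (Unique-reverseComplement⁺ w∈) Unique-reverseComplement⁻)
             (uniqueℕ? w) (uniqueℕ? (rc w))))) (words-All (letters n) n)) ⟩
    (Σ[ ws ] λ w → if does (uniqueℕ? (rc w)) then f (rc w) else 0#)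
      ≈⟨ Σ-words-reverse-map (map suc (upTo n)) (complement n) (Σ-complement n) n _ ⟩
    (Σ[ ws ] λ w → if does (uniqueℕ? w) then f w else 0#)
      ≈⟨ Σ-filter uniqueℕ? ws f ⟨
    Σ[ 𝔖 n ] f ∎
    where
    rc = reverseComplement n
    ws = words (map suc (upTo n)) n

  -- Signed permutations as permutations with a choice of signs

  Σ± : List ℕ → (List ℤ → Carrier) → Carrier
  Σ± []      f = f []
  Σ± (a ∷ u) f = Σ± u (f ∘ (+ a ∷_)) + Σ± u (f ∘ (ℤ.- + a ∷_))

  -- The summands are compared with the underlying word known, so that a condition on `w` can be
  -- traded for one on `u`.
  Σ±-cong : ∀ u {f g} → (∀ w → map ∣_∣ w ≡ u → f w ≈ g w) → Σ± u f ≈ Σ± u g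
  Σ±-cong []      e = e [] ≡.refl
  Σ±-cong (a ∷ u) e = +-cong
    (Σ±-cong u λ w w≡u → e (+ a ∷ w) (≡.cong (a ∷_) w≡u))
    (Σ±-cong u λ w w≡u → e (ℤ.- + a ∷ w) (≡.cong₂ _∷_ (ℤ.∣-i∣≡∣i∣ (+ a)) w≡u))

  Σ±-*ˡ : ∀ a u f → Σ± u (λ w → a * f w) ≈ a * Σ± u f
  Σ±-*ˡ a []      f = refl
  Σ±-*ˡ a (b ∷ u) f =
    trans (+-cong (Σ±-*ˡ a u _) (Σ±-*ˡ a u _)) (sym (distribˡ a _ _))

  Σ±-if : ∀ b u f → Σ± u (λ w → if b then f w else 0#) ≈ (if b then Σ± u f else 0#)
  Σ±-if true  u       f = refl
  Σ±-if false []      f = refl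
  Σ±-if false (a ∷ u) f =
    trans (+-cong (Σ±-if false u (f ∘ (+ a ∷_))) (Σ±-if false u (f ∘ (ℤ.- + a ∷_))))
      (+-identityˡ 0#)

  Σ-integers : ∀ n g →
    Σ[ integers n ] g ≈ g 0ℤ + Σ[ map suc (upTo n) ] λ k → g (+ k) + g (ℤ.- + k)
  Σ-integers zero    g = refl
  Σ-integers (suc n) g = begin
    Σ[ integers (suc n) ] g
      ≈⟨ Σ-≡ g (integers-suc n) ⟩
    g -[1+ n ] + Σ[ integers n ∷ʳ + suc n ] g
      ≈⟨ +-congˡ (trans (Σ-∷ʳ (integers n) (+ suc n) g) (+-congʳ (Σ-integers n g))) ⟩
    g -[1+ n ] + (g 0ℤ + Σ[ map suc (upTo n) ] h + g (+ suc n))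
      ≈⟨ solve 4 (λ a b c d → a :+ (b :+ c :+ d) := b :+ (c :+ (d :+ a))) refl _ _ _ _ ⟩
    g 0ℤ + (Σ[ map suc (upTo n) ] h + h (suc n))
      ≈⟨ +-congˡ (Σ-∷ʳ (map suc (upTo n)) (suc n) h) ⟨
    g 0ℤ + Σ[ map suc (upTo n) ∷ʳ suc n ] h
      ≈⟨ +-congˡ (Σ-≡ h (≡.trans
           (≡.sym (List.map-++ suc (upTo n) (n ∷ []))) (≡.cong (map suc) (List.upTo-∷ʳ n)))) ⟩
    g 0ℤ + Σ[ map suc (upTo (suc n)) ] h ∎
    where
    open SemiringSolver commutativeSemiring using (solve; _:=_; _:+_)
    h = λ k → g (+ k) + g (ℤ.- + k)

  -- Words containing 0 contribute nothing, so each letter is a positive letter with a sign. The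
  -- length `m` is kept apart from `n` because the induction shortens words over a fixed alphabet.
  Σ-words-integers : ∀ n m f → (∀ w → 0ℤ ∈ w → f w ≈ 0#) →
    Σ[ words (integers n) m ] f ≈ Σ[ words (map suc (upTo n)) m ] λ u → Σ± u f
  Σ-words-integers n zero    f vanish = refl
  Σ-words-integers n (suc m) f vanish = begin
    Σ[ words (integers n) (suc m) ] f
      ≈⟨ Σ-words-∷ (integers n) m f ⟩
    (Σ[ integers n ] λ a → Σ[ words (integers n) m ] λ w → f (a ∷ w))
      ≈⟨ Σ-integers n _ ⟩
    (Σ[ words (integers n) m ] λ w → f (0ℤ ∷ w)) +
    (Σ[ ks ] λ k → Σ[ words (integers n) m ] (λ w → f (+ k ∷ w))
                 + Σ[ words (integers n) m ] (λ w → f (ℤ.- + k ∷ w)))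
      ≈⟨ +-cong (Σ-zero (words (integers n) m) λ w → vanish _ (here ≡.refl))
           (Σ-cong′ ks λ k → trans
             (+-cong (Σ-words-integers n m _ λ w 0∈w → vanish _ (there 0∈w))
                     (Σ-words-integers n m _ λ w 0∈w → vanish _ (there 0∈w)))
             (sym (Σ-+ (words ks m) _ _))) ⟩
    0# + (Σ[ ks ] λ k → Σ[ words ks m ] λ u → Σ± (k ∷ u) f)
      ≈⟨ +-identityˡ _ ⟩
    (Σ[ ks ] λ k → Σ[ words ks m ] λ u → Σ± (k ∷ u) f)
      ≈⟨ Σ-words-∷ ks m (λ u → Σ± u f) ⟨
    (Σ[ words ks (suc m) ] λ u → Σ± u f) ∎
    where ks = map suc (upTo n)

  -- The antisymmetric extension of `w` is injective exactly when the letters are nonzero with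
  -- distinct absolute values. Membership in `𝔅 n` is therefore a condition on absolute values
  -- alone, and the signs are free.
  Σ-𝔅 : ∀ n f → Σ[ 𝔅 n ] f ≈ Σ[ 𝔖 n ] λ u → Σ± u f
  Σ-𝔅 n f = begin
    Σ[ 𝔅 n ] f
      ≈⟨ Σ-filter (λ w → uniqueℤ? (symmetricWord w)) (words (integers n) n) f ⟩
    Σ[ words (integers n) n ] g
      ≈⟨ Σ-words-integers n n g vanish ⟩
    (Σ[ ws ] λ u → Σ± u g)
      ≈⟨ Σ-cong (All.map
           (λ {u} u∈ → trans (Σ±-cong u λ w → unsign w u∈) (Σ±-if (does (uniqueℕ? u)) u f))
           (words-All (letters n) n)) ⟩
    (Σ[ ws ] λ u → if does (uniqueℕ? u) then Σ± u f else 0#)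
      ≈⟨ Σ-filter uniqueℕ? ws (λ u → Σ± u f) ⟨
    (Σ[ 𝔖 n ] λ u → Σ± u f) ∎
    where
    ws = words (map suc (upTo n)) n
    g  = λ w → if does (uniqueℤ? (symmetricWord w)) then f w else 0#

    vanish : ∀ w → 0ℤ ∈ w → g w ≈ 0#
    vanish w 0∈w = reflexive (≡.cong (λ b → if b then f w else 0#)
      (dec-false (uniqueℤ? (symmetricWord w))
        λ u → All.lookup (symmetric-unique⇒≢0 u) 0∈w ≡.refl))

    unsign : ∀ w {u} → All (Letter n) u → map ∣_∣ w ≡ u →
      g w ≈ (if does (uniqueℕ? u) then f w else 0#)
    unsign w u∈ ≡.refl = reflexive (≡.cong (λ b → if b then f w else 0#)
      (does-⇔ (mk⇔ symmetric-unique⁻ (symmetric-unique⁺ nonzero))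
        (uniqueℤ? (symmetricWord w)) (uniqueℕ? (map ∣_∣ w))))
      where
      nonzero : All (_≢ 0ℤ) w
      nonzero = All.map (λ { (() , _) ≡.refl }) (All.map⁻ u∈)

-- The sum over signs

module SignSum {c ℓ} (R : CommutativeRing c ℓ) (y t : CommutativeRing.Carrier R) where
  open CommutativeRing R hiding (zero)
  open Enumerators R using (_^_; Σ[_]_; P; F)
  open Sums R
  open Exp semiring using (^-congʳ; ^-assocʳ)
  open SetoidReasoning (CommutativeRing.setoid R)
  open SemiringSolver commutativeSemiring using (solve; _:=_; _:+_; _:*_; con)

  -- Every descent counts twice in `fdes`, apart from the one that a negative first letter makes
  -- with 0, which counts once.
  q : Carrier
  q = t ^ 2

  -- The factor of a letter with an ascent of σ on either side.
  κ : Carrier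
  κ = 1# + y * q

  infix 8 _^?_
  _^?_ : Carrier → Bool → Carrier
  x ^? b = if b then x else 1#

  ^-indicator : ∀ x b m → x ^ ((if b then 1 else 0) ℕ.+ m) ≈ x ^? b * x ^ m
  ^-indicator x true  m = refl
  ^-indicator x false m = sym (*-identityˡ _)

  -- `x` is the signed letter in front of `u`; it matters only for the descent it may form with the
  -- next letter.
  K : ℤ → List ℕ → Carrier
  K x u = Σ± u λ w → y ^ neg w * q ^ desℤ (x ∷ w)

  K-∷ : ∀ x b u → K x (suc b ∷ u) ≈
    q ^? does (+ suc b ℤ.<? x) * K (+ suc b) u +
    y * q ^? does (-[1+ b ] ℤ.<? x) * K -[1+ b ] u
  K-∷ x b u = +-cong
    (trans (Σ±-cong u λ w _ → trans (*-congˡ (^-indicator q _ _))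
              (solve 3 (λ n i d → n :* (i :* d) := i :* (n :* d)) refl _ _ _))
           (Σ±-*ˡ _ u _))
    (trans (Σ±-cong u λ w _ → trans (*-congˡ (^-indicator q _ _))
              (solve 4 (λ y n i d → (y :* n) :* (i :* d) := (y :* i) :* (n :* d)) refl _ _ _ _))
           (Σ±-*ˡ _ u _))

  -- s is the total weight of a minus sign on the first letter, including that of
  -- any descent it creates in front of this letter.
  M : Carrier → ℕ → List ℕ → Carrier
  M s b u = K (+ b) u + s * K (ℤ.- + b) u

  -- One factor per letter: `s` weighs its minus sign, `d` tells whether a descent of σ follows it.
  -- The last letter gets `1# + s`, as if an ascent followed.
  steps : Carrier → List Bool → Carrier
  steps s []      = 1# + s
  steps s (d ∷ p) = (q ^? d + s) * steps (q ^? not d * y) p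

  -- If `a` exceeds `b`, there is a descent exactly when the first letter is positive, whatever the
  -- sign of the second. Otherwise there is one exactly when the second letter is negative. Either
  -- way the sum over the first sign factors out.
  M-∷ : ∀ s {a b} u → a ≢ b → let d = does (b ℕ.<? a) in
    M s (suc a) (suc b ∷ u) ≈ (q ^? d + s) * M (q ^? not d * y) (suc b) u
  M-∷ s {a} {b} u a≢b = begin
    M s (suc a) (suc b ∷ u)
      -- The comparisons of signed letters compute: opposite signs are decided outright, equal signs
      -- reduce to a comparison in ℕ.
      ≈⟨ +-cong (K-∷ (+ suc a) b u) (*-congˡ (K-∷ -[1+ a ] b u)) ⟩
    (q ^? d * k⁺ + y * q * k⁻) + s * (1# * k⁺ + y * q ^? does (a ℕ.<? b) * k⁻)
      ≈⟨ +-congˡ (*-congˡ (+-congˡ (*-congʳ (*-congˡ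
           (reflexive (≡.cong (q ^?_) (does-<?-flip a≢b))))))) ⟩
    (q ^? d * k⁺ + y * q * k⁻) + s * (1# * k⁺ + y * q ^? not d * k⁻)
      ≈⟨ collect d ⟩
    (q ^? d + s) * M (q ^? not d * y) (suc b) u ∎
    where
    d  = does (b ℕ.<? a)
    k⁺ = K (+ suc b) u
    k⁻ = K -[1+ b ] u
    collect : ∀ d → (q ^? d * k⁺ + y * q * k⁻) + s * (1# * k⁺ + y * q ^? not d * k⁻)
      ≈ (q ^? d + s) * (k⁺ + q ^? not d * y * k⁻)
    collect true  = solve 5 (λ q y s k l →
      (q :* k :+ y :* q :* l) :+ s :* (con 1 :* k :+ y :* con 1 :* l)
      := (q :+ s) :* (k :+ con 1 :* y :* l)) refl q y s k⁺ k⁻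
    collect false = solve 5 (λ q y s k l →
      (con 1 :* k :+ y :* q :* l) :+ s :* (con 1 :* k :+ y :* q :* l)
      := (con 1 :+ s) :* (k :+ q :* y :* l)) refl q y s k⁺ k⁻

  M≈steps : ∀ s {n a u} → All (Letter n) (a ∷ u) → Unique (a ∷ u) →
    M s a u ≈ steps s (descents (a ∷ u))
  M≈steps s {a = suc a} {[]} _ _ =
    solve 1 (λ s → con 1 :* con 1 :+ s :* (con 1 :* con 1) := con 1 :+ s) refl s
  M≈steps s {a = suc a} {suc b ∷ u} (_ ∷ u∈) ((a≢b ∷ _) ∷ u!) =
    trans (M-∷ s u (a≢b ∘ ≡.cong suc)) (*-congˡ (M≈steps _ u∈ u!))
  M≈steps s {a = suc a} {zero ∷ u} (_ ∷ (() , _) ∷ _) _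
  M≈steps s {a = zero} ((() , _) ∷ _) _

  t^2m≈q^m : ∀ m → t ^ (2 ℕ.* m) ≈ q ^ m
  t^2m≈q^m m = sym (^-assocʳ t 2 m)

  -- The descent created by a negative first letter costs `t` instead of `q`, whence the initial
  -- weight `y * t`.
  signSum : ∀ {n a u} → All (Letter n) (a ∷ u) → Unique (a ∷ u) →
    Σ± (a ∷ u) (λ w → y ^ neg w * t ^ fdes w) ≈ steps (y * t) (descents (a ∷ u))
  signSum {a = zero} ((() , _) ∷ _) _
  signSum {a = suc a} {u} u∈ u! = begin
    Σ± (suc a ∷ u) (λ w → y ^ neg w * t ^ fdes w)
      ≈⟨ +-cong
           (Σ±-cong u λ w _ → *-congˡ (t^2m≈q^m (desℤ (+ suc a ∷ w))))
           (trans
             (Σ±-cong u λ w _ → trans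
               -- With D descents after the initial one, `2 * (1 + D) ∸ 1` reduces to
               -- `D + suc (D + 0)`, which becomes `suc (2 * D)`.
               (*-congˡ (trans (^-congʳ t (ℕ.+-suc (desℤ (-[1+ a ] ∷ w)) _))
                               (*-congˡ (t^2m≈q^m (desℤ (-[1+ a ] ∷ w))))))
               (solve 4 (λ y n t d → (y :* n) :* (t :* d) := (y :* t) :* (n :* d)) refl _ _ _ _))
             (Σ±-*ˡ (y * t) u _)) ⟩
    M (y * t) (suc a) u
      ≈⟨ M≈steps (y * t) u∈ u! ⟩
    steps (y * t) (descents (suc a ∷ u)) ∎

  -- W is the factor by which the two sides differ on a suffix of a pattern that
  -- starts with a descent; the last hypothesis makes it disappear at the front.
  module _ (Y Z T W : Carrier)
    (κT≈y+q       : κ * T ≈ y + q)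
    (κZ≈q[1+y]W   : κ * Z ≈ q * (1# + y) * W)
    (WκYT≈1+y     : W * (κ * (Y * T)) ≈ 1# + y)
    ([q+yt]W≈1+yt : (q + y * t) * W ≈ 1# + y * t)
    where

    -- Y ^ lpk * Z ^ val * T ^ des for the reverse-complement of a word with the
    -- given descent pattern.
    weight : List Bool → Carrier
    weight p = Y ^ adjacent (flip upDown) (p ∷ʳ false) * Z ^ adjacent upDown p * T ^ count p

    weight-reverseComplement : ∀ {n w} → All (Letter n) w → Unique w →
      let v = reverseComplement n w in
      Y ^ lpk v * Z ^ val v * T ^ des v ≡ weight (descents w)
    weight-reverseComplement {n} {w} w∈ w!
      rewrite lpk≡ (Unique-reverseComplement⁺ w∈ w!)
            | val≡ (Unique-reverseComplement⁺ w∈ w!)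
            | des≡ (reverseComplement n w)
            | descents-reverseComplement w∈
            -- The fictitious ascent at the left end of the reversed pattern becomes one at the
            -- right end of the original.
            | ≡.sym (List.reverse-++ (descents w) (false ∷ []))
            | adjacent-reverse upDown (descents w ∷ʳ false)
            | adjacent-reverse (flip upDown) (descents w)
            | count-reverse (descents w) = ≡.refl

    -- The factor of `weight` at a letter between the steps `c` and `d`. `Y` goes with
    -- descent-ascent, since the reverse-complement reads this pair backwards, as a peak. Each
    -- descent is charged to the letter after it.
    turn : Bool → Bool → Carrier
    turn c d = Y ^? flip upDown c d * Z ^? upDown c d * T ^? c

    weight-∷ : ∀ c d p → weight (c ∷ d ∷ p) ≈ turn c d * weight (d ∷ p)
    weight-∷ c d p = trans
      (*-cong (*-cong (^-indicator Y (flip upDown c d) _) (^-indicator Z (upDown c d) _))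
              (^-indicator T c _))
      (solve 6 (λ y a z b t e → (y :* a) :* (z :* b) :* (t :* e)
        := (y :* z :* t) :* (a :* b :* e)) refl _ _ _ _ _ _)

    weight-[_] : ∀ c → weight (c ∷ []) ≈ turn c false
    weight-[ true  ] = solve 2 (λ Y T → (Y :* con 1) :* con 1 :* (T :* con 1)
                          := Y :* con 1 :* T) refl Y T
    weight-[ false ] = refl

    -- The local comparison of a letter's factor with `κ * turn c d`. The powers of `W` on the two
    -- sides cancel between neighbouring letters, so the discrepancy telescopes. Two ascents give
    -- the definition of `κ`; the other cases are three of the hypotheses.
    W^?-step : ∀ c d → (q ^? d + q ^? not c * y) * W ^? d ≈ W ^? c * (κ * turn c d)
    W^?-step false false = solve 2 (λ q y → (con 1 :+ q :* y) :* con 1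
      := con 1 :* ((con 1 :+ y :* q) :* (con 1 :* con 1 :* con 1))) refl q y
    W^?-step false true  = begin
      (q + q * y) * W
        ≈⟨ solve 3 (λ q y w → (q :+ q :* y) :* w := q :* (con 1 :+ y) :* w) refl q y W ⟩
      q * (1# + y) * W
        ≈⟨ κZ≈q[1+y]W ⟨
      κ * Z
        ≈⟨ solve 2 (λ k z → k :* z := con 1 :* (k :* (con 1 :* z :* con 1))) refl κ Z ⟩
      1# * (κ * (1# * Z * 1#)) ∎
    W^?-step true false = begin
      (1# + 1# * y) * 1#
        ≈⟨ solve 1 (λ y → (con 1 :+ con 1 :* y) :* con 1 := con 1 :+ y) refl y ⟩
      1# + y
        ≈⟨ WκYT≈1+y ⟨
      W * (κ * (Y * T))
        ≈⟨ *-congˡ (*-congˡ (*-congʳ (*-identityʳ Y))) ⟨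
      W * (κ * (Y * 1# * T)) ∎
    W^?-step true true = begin
      (q + 1# * y) * W
        ≈⟨ solve 3 (λ q y w → (q :+ con 1 :* y) :* w := w :* (y :+ q)) refl q y W ⟩
      W * (y + q)
        ≈⟨ *-congˡ κT≈y+q ⟨
      W * (κ * T)
        ≈⟨ solve 3 (λ w k t → w :* (k :* t) := w :* (k :* (con 1 :* con 1 :* t))) refl W κ T ⟩
      W * (κ * (1# * 1# * T)) ∎

    steps≈weight : ∀ c p →
      steps (q ^? not c * y) p ≈ W ^? c * (κ ^ suc (length p) * weight (c ∷ p))
    steps≈weight c [] = begin
      1# + q ^? not c * y
        ≈⟨ *-identityʳ _ ⟨
      (1# + q ^? not c * y) * 1#
        -- The end of the word acts as an ascent, for which the power of `W` is 1.
        ≈⟨ W^?-step c false ⟩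
      W ^? c * (κ * turn c false)
        ≈⟨ *-congˡ (*-cong (*-identityʳ κ) weight-[ c ]) ⟨
      W ^? c * (κ ^ 1 * weight (c ∷ [])) ∎
    steps≈weight c (d ∷ p) = begin
      s * steps (q ^? not d * y) p
        ≈⟨ *-congˡ (steps≈weight d p) ⟩
      s * (W ^? d * (κ ^ suc (length p) * weight (d ∷ p)))
        ≈⟨ *-assoc _ _ _ ⟨
      s * W ^? d * (κ ^ suc (length p) * weight (d ∷ p))
        ≈⟨ *-congʳ (W^?-step c d) ⟩
      W ^? c * (κ * turn c d) * (κ ^ suc (length p) * weight (d ∷ p))
        ≈⟨ solve 5 (λ w k r e h → w :* (k :* r) :* (e :* h) := w :* (k :* e :* (r :* h)))
             refl _ _ _ _ _ ⟩
      W ^? c * (κ ^ suc (suc (length p)) * (turn c d * weight (d ∷ p)))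
        ≈⟨ *-congˡ (*-congˡ (weight-∷ c d p)) ⟨
      W ^? c * (κ ^ suc (suc (length p)) * weight (c ∷ d ∷ p)) ∎
      where s = q ^? d + q ^? not c * y

    -- The first letter has no step before it. Its factor, times the `W` left over from the suffix,
    -- is `1# + y * t` whether or not a descent follows; only the remaining letters contribute `κ`.
    steps-yt≈weight : ∀ p → steps (y * t) p ≈ (1# + y * t) * κ ^ length p * weight p
    steps-yt≈weight []      =
      solve 1 (λ x → x := x :* con 1 :* (con 1 :* con 1 :* con 1)) refl _
    steps-yt≈weight (d ∷ p) = begin
      (q ^? d + y * t) * steps (q ^? not d * y) p
        ≈⟨ *-congˡ (steps≈weight d p) ⟩
      (q ^? d + y * t) * (W ^? d * (κ ^ suc (length p) * weight (d ∷ p)))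
        ≈⟨ *-assoc _ _ _ ⟨
      (q ^? d + y * t) * W ^? d * (κ ^ suc (length p) * weight (d ∷ p))
        ≈⟨ *-congʳ (first-step d) ⟩
      (1# + y * t) * (κ ^ suc (length p) * weight (d ∷ p))
        ≈⟨ *-assoc _ _ _ ⟨
      (1# + y * t) * κ ^ suc (length p) * weight (d ∷ p) ∎
      where
      first-step : ∀ d → (q ^? d + y * t) * W ^? d ≈ 1# + y * t
      first-step true  = [q+yt]W≈1+yt
      first-step false = *-identityʳ _

    F≈P : ∀ n → F (suc n) y t ≈ (1# + y * t) * κ ^ n * P (suc n) Y Z T
    F≈P n = begin
      F (suc n) y t
        ≈⟨ Σ-𝔅 (suc n) _ ⟩
      (Σ[ 𝔖 (suc n) ] λ u → Σ± u λ w → y ^ neg w * t ^ fdes w)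
        ≈⟨ Σ-cong (All.map (λ {u} → signed u) (𝔖-All (suc n))) ⟩
      (Σ[ 𝔖 (suc n) ] λ u → (1# + y * t) * κ ^ n * stat (reverseComplement (suc n) u))
        ≈⟨ Σ-𝔖-reverseComplement (suc n) _ ⟩
      (Σ[ 𝔖 (suc n) ] λ u → (1# + y * t) * κ ^ n * stat u)
        ≈⟨ Σ-*ˡ _ (𝔖 (suc n)) stat ⟩
      (1# + y * t) * κ ^ n * P (suc n) Y Z T ∎
      where
      stat : List ℕ → Carrier
      stat w = Y ^ lpk w * Z ^ val w * T ^ des w

      signed : ∀ u → All (Letter (suc n)) u × length u ≡ suc n × Unique u →
        Σ± u (λ w → y ^ neg w * t ^ fdes w) ≈
        (1# + y * t) * κ ^ n * stat (reverseComplement (suc n) u)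
      signed (a ∷ u) (u∈ , ≡.refl , u!) = begin
        Σ± (a ∷ u) (λ w → y ^ neg w * t ^ fdes w)
          ≈⟨ signSum u∈ u! ⟩
        steps (y * t) (descents (a ∷ u))
          ≈⟨ steps-yt≈weight (descents (a ∷ u)) ⟩
        (1# + y * t) * κ ^ length (descents (a ∷ u)) * weight (descents (a ∷ u))
          ≡⟨ ≡.cong₂ (λ m x → (1# + y * t) * κ ^ m * x)
               (length-descents a u) (≡.sym (weight-reverseComplement u∈ u!)) ⟩
        (1# + y * t) * κ ^ length u * stat (reverseComplement (suc (length u)) (a ∷ u)) ∎

-- Substitution of the quotients

module QuotientIdentity {c ℓ} (D : IntegralDomain c ℓ) where
  open IntegralDomain D hiding (zero)
  open Enumerators commutativeRing
  open SetoidReasoning (CommutativeRing.setoid commutativeRing)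
  open SemiringSolver commutativeSemiring using (solve; _:=_; _:+_; _:*_; con)

  -- The quotients are given by equations with cleared denominators, and the hypotheses of `F≈P`
  -- follow by cancelling nonzero factors.
  F≈P-quotients : ∀ y t Y Z T W →
    ¬ t ≈ 0# → ¬ y + t ^ 2 ≈ 0# → ¬ 1# + y * t ≈ 0# → ¬ y + t ≈ 0# →
    Y * ((y + t ^ 2) * (1# + y * t)) ≈ t * (1# + y) * (y + t) →
    Z * ((1# + y * t ^ 2) * (y + t)) ≈ t * (1# + y) * (1# + y * t) →
    T * (1# + y * t ^ 2) ≈ y + t ^ 2 →
    W * (t * (y + t)) ≈ 1# + y * t →
    ∀ n → F (suc n) y t ≈ (1# + y * t) * (1# + y * t ^ 2) ^ n * P (suc n) Y Z T
  F≈P-quotients y t Y Z T W t≉0 y+q≉0 1+yt≉0 y+t≉0 eY eZ eT eW =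
    SignSum.F≈P commutativeRing y t Y Z T W
      (trans (*-comm κ T) eT)
      (*-cancelˡ y+t≉0 (begin
        (y + t) * (κ * Z)
          ≈⟨ solve 3 (λ s k z → s :* (k :* z) := z :* (k :* s)) refl (y + t) κ Z ⟩
        Z * (κ * (y + t))
          ≈⟨ eZ ⟩
        t * (1# + y) * (1# + y * t)
          ≈⟨ *-congˡ eW ⟨
        t * (1# + y) * (W * (t * (y + t)))
          -- `t ^ 2` unfolds to `t * (t * 1#)`, the form in which it is given to the solver.
          ≈⟨ solve 4 (λ t x w s → t :* x :* (w :* (t :* s))
               := s :* ((t :* (t :* con 1)) :* x :* w)) refl t (1# + y) W (y + t) ⟩
        (y + t) * (t ^ 2 * (1# + y) * W) ∎))
      (*-cancelˡ (*-≉0 y+q≉0 1+yt≉0) (begin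
        d * (W * (κ * (Y * T)))
          ≈⟨ solve 5 (λ d w k Y T → d :* (w :* (k :* (Y :* T)))
               := (w :* (T :* k)) :* (Y :* d)) refl d W κ Y T ⟩
        (W * (T * κ)) * (Y * d)
          ≈⟨ *-cong (*-congˡ eT) eY ⟩
        (W * (y + t ^ 2)) * (t * (1# + y) * (y + t))
          ≈⟨ solve 5 (λ w e t x s → (w :* e) :* (t :* x :* s)
               := (e :* (w :* (t :* s))) :* x) refl W (y + t ^ 2) t (1# + y) (y + t) ⟩
        ((y + t ^ 2) * (W * (t * (y + t)))) * (1# + y)
          ≈⟨ *-congʳ (*-congˡ eW) ⟩
        d * (1# + y) ∎))
      -- Since `t ^ 2 + y * t` is `t * (y + t)`, this condition dictates the choice of `W`.
      (trans
        (solve 3 (λ t y w → (t :* (t :* con 1) :+ y :* t) :* w := w :* (t :* (y :+ t)))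
          refl t y W)
        eW)
    where
    κ = 1# + y * t ^ 2
    d = (y + t ^ 2) * (1# + y * t)

t≉0 : let open ℚ⟨y,t⟩ in ¬ t ≈ 0#
-- In the cross-multiplied equation the coefficients of t in degree 1, y in degree 0, are 1 and 0.
t≉0 e with ℚ[y].coeff≈ (ℚ[y][t].coeff≈ (Frac-ℚ[y][t].cross e) 1) 0
... | ()

theorem4p17 : let open ℚ⟨y,t⟩ in
    (n : ℕ) → n ≥ 1 →
    F n y t ≈
    (1# + y * t) * (1# + y * t ^ 2) ^ (n ∸ 1) *
    P n
    ((t * (1# + y) * (y + t)) ÷ ((y + t ^ 2) * (1# + y * t)) [ *-≉0 y+t²≉0 1+yt≉0 ])
    ((t * (1# + y) * (1# + y * t)) ÷ ((1# + y * t ^ 2) * (y + t)) [ *-≉0 1+yt²≉0 y+t≉0 ])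
    ((y + t ^ 2) ÷ (1# + y * t ^ 2) [ 1+yt²≉0 ])
theorem4p17 (suc n) _ =
  QuotientIdentity.F≈P-quotients Frac-ℚ[y][t].integralDomain y t
    (numY ÷ denY [ denY≉0 ]) (numZ ÷ denZ [ denZ≉0 ])
    ((y + t ^ 2) ÷ (1# + y * t ^ 2) [ 1+yt²≉0 ]) ((1# + y * t) ÷ denW [ denW≉0 ])
    t≉0 y+t²≉0 1+yt≉0 y+t≉0
    (÷ᶠ-spec numY denY denY≉0)
    (÷ᶠ-spec numZ denZ denZ≉0)
    (÷ᶠ-spec (y + t ^ 2) (1# + y * t ^ 2) 1+yt²≉0)
    (÷ᶠ-spec (1# + y * t) denW denW≉0)
    n
  where
  open ℚ⟨y,t⟩
  open Frac-ℚ[y][t] using (÷ᶠ-spec)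
  numY = t * (1# + y) * (y + t)
  denY = (y + t ^ 2) * (1# + y * t)
  numZ = t * (1# + y) * (1# + y * t)
  denZ = (1# + y * t ^ 2) * (y + t)
  -- The denominator of the auxiliary `W`, which does not occur in the identity itself.
  denW = t * (y + t)
  denY≉0 : ¬ denY ≈ 0#
  denY≉0 = *-≉0 {y + t ^ 2} {1# + y * t} y+t²≉0 1+yt≉0
  denZ≉0 : ¬ denZ ≈ 0#
  denZ≉0 = *-≉0 {1# + y * t ^ 2} {y + t} 1+yt²≉0 y+t≉0
  denW≉0 : ¬ denW ≈ 0#
  denW≉0 = *-≉0 {t} {y + t} t≉0 y+t≉0
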